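{- Let $n\ge 4$ be an even integer and let $\mathscr{A}$ and $\mathscr{B}$ be two antichains of $\mathbb{N}_n=\{1,\dots,n\}$. Suppose that for some integer $k\le \min\{|\mathscr{A}|,|\mathscr{B}|\}$ the members can be enumerated as $\mathscr{A}=\{A_1,A_2,\dots\}$, $\mathscr{B}=\{B_1,B_2,\dots\}$ so that for all $A_i\in\mathscr{A}$, $B_j\in\mathscr{B}$, $A_i\cap B_j=\emptyset$ only if $i=j\le k$ (i.e. there are at most $k$ non-intersecting pairs). Then $$|\mathscr{A}|+|\mathscr{B}|\le \binom{n}{n/2}+\binom{n}{n/2+1}-\kappa^*_{n/2}(k),$$ where $\kappa^*_{n/2}(k)=0$ if $k<1+\sum_{i=1}^{n/2}\binom{2i-1}{i}$ and $\kappa^*_{n/2}(k)<0$ otherwise. Furthermore, equality holds if (i) $k<1+\sum_{i=1}^{n/2}\binom{2i-1}{i}$, $\mathscr{A}=\binom{\mathbb{N}_n}{n/2}$ and $\mathscr{B}=\binom{\mathbb{N}_n}{n/2+1}$; or (ii) $k\ge 1+\sum_{i=1}^{n/2}\binom{2i-1}{i}$, $\mathscr{A}=\binom{\mathbb{N}_n}{n/2}$ and $\mathscr{B}=L_{n,n/2}(m)\cup\Big(\binom{\mathbb{N}_n}{n/2+1}\setminus\nabla L_{n,n/2}(m)\Big)$, where $m\le k$ is an integer such that $\kappa^*_{n/2}(k)=\kappa_{n/2}(m)$.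
   Context: An antichain of $\mathbb{N}_n$ is a family of subsets no member of which is contained in another. $\binom{\mathbb{N}_n}{r}$ denotes the family of all $r$-subsets of $\mathbb{N}_n$. For a family $\mathscr{F}$ of $r$-sets, its shadow is $\Delta\mathscr{F}=\{X:|X|=r-1, X\subset Y \text{ for some } Y\in\mathscr{F}\}$ and its shade is $\nabla\mathscr{F}=\{X\subseteq\mathbb{N}_n:|X|=r+1, Y\subset X\text{ for some }Y\in\mathscr{F}\}$. Squashed order on $r$-subsets: $A<_s B$ if $A\ne B$ and the largest element of the symmetric difference $(A\setminus B)\cup(B\setminus A)$ lies in $B$. $F_{n,r}(m)$ (resp. $L_{n,r}(m)$) denotes the family of the first (resp. last) $m$ $r$-subsets of $\mathbb{N}_n$ in squashed order. Every nonnegative integer $m$ has a unique $r$-binomial representation $m=\sum_{i=t}^{r}\binom{a_i}{i}$ with $a_r>a_{r-1}>\dots>a_t\ge t\ge 1$ (empty sum for $m=0$). The Kruskal–Katona function is $\kappa_r(m):=\sum_{i=t}^{r}\binom{a_i}{i-1}-m$, which equals $|\Delta F_{n,r}(m)|-m$ whenever $m\le\binom{n}{r}$; and $\kappa^*_r(m):=\min_{0\le j\le m}\kappa_r(j)$. -}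

module Defs where

open import Data.Bool using (Bool; true; false; not; _∧_; if_then_else_)
open import Data.Nat using (ℕ; zero; suc; _+_; _*_; _∸_; _<_; _≤ᵇ_; _≡ᵇ_)
open import Data.Nat.Combinatorics using (_C_)
open import Data.Integer as ℤ using (ℤ; +_; _⊓_)
open import Data.List using (List; []; _∷_; _++_; map; length; filterᵇ)
open import Data.Vec using (Vec; []; _∷_)
open import Data.Fin using (Fin; toℕ)
open import Data.Fin.Subset using (Subset; _∈_; _⊆_; ∣_∣; Empty; _∩_)
open import Data.Product using (Σ; ∃; _×_; _,_)
open import Data.Sum using (_⊎_)
open import Relation.Nullary using (¬_)
open import Relation.Binary.PropositionalEquality using (_≡_)
open import Function.Bundles using (_⇔_)
import Data.List.Membership.Propositional as LM
open import Data.List.Relation.Unary.Unique.Propositional using (Unique)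

-- Kruskal–Katona function via the r-binomial (cascade) representation.
-- The representation m = Σ_{i=t}^{r} C(a_i,i) is computed greedily:
-- a_r is the largest a with C(a,r) ≤ m (it satisfies a ≤ m + r), and the
-- remainder m - C(a_r,r) is represented with r-1; we stop at m = 0.

topA : ℕ → ℕ → ℕ → ℕ
topA r m zero    = zero
topA r m (suc b) = if (suc b) C r ≤ᵇ m then suc b else topA r m b

shadowSum : ℕ → ℕ → ℕ
shadowSum zero    m       = zero
shadowSum (suc r) zero    = zero
shadowSum (suc r) (suc m) =
  let a = topA (suc r) (suc m) (suc m + suc r)
  in a C r + shadowSum r (suc m ∸ a C (suc r))

κ : ℕ → ℕ → ℤ
κ r m = (+ shadowSum r m) ℤ.- (+ m)

κ* : ℕ → ℕ → ℤ
κ* r zero    = κ r zero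
κ* r (suc m) = κ* r m ⊓ κ r (suc m)

sumT : ℕ → ℕ
sumT zero    = zero
sumT (suc i) = sumT i + (suc (2 * i)) C (suc i)

threshold : ℕ → ℕ
threshold h = suc (sumT h)

-- Subsets of ℕ_n are represented by Subset n (element i+1 ↔ index i).

allSubsets : (n : ℕ) → List (Subset n)
allSubsets zero    = [] ∷ []
allSubsets (suc n) = map (false ∷_) (allSubsets n) ++ map (true ∷_) (allSubsets n)

eqᵇ : ∀ {n} → Subset n → Subset n → Bool
eqᵇ []       []       = true
eqᵇ (x ∷ xs) (y ∷ ys) = (if x then y else not y) ∧ eqᵇ xs ys

-- squashed order: A <_s B iff A ≠ B and the largest element of the
-- symmetric difference lies in B.  Vectors list elements from the
-- smallest (head) to the largest, so we look at the tail first.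
_<ₛ_ : ∀ {n} → Subset n → Subset n → Bool
[]       <ₛ []       = false
(x ∷ xs) <ₛ (y ∷ ys) = if eqᵇ xs ys then (not x ∧ y) else (xs <ₛ ys)

numAfter : ∀ {n} → ℕ → Subset n → ℕ
numAfter {n} r X = length (filterᵇ (λ Y → (∣ Y ∣ ≡ᵇ r) ∧ (X <ₛ Y)) (allSubsets n))

-- membership in L_{n,r}(m): the last m r-subsets in squashed order
InL : ∀ {n} → ℕ → ℕ → Subset n → Set
InL r m X = (∣ X ∣ ≡ r) × (numAfter r X < m)

InShadeL : ∀ {n} → ℕ → ℕ → Subset n → Set
InShadeL {n} r m X = (∣ X ∣ ≡ suc r) × ∃ λ (Y : Subset n) → InL r m Y × (Y ⊆ X)

Level : ∀ {n} → ℕ → Subset n → Set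
Level r X = ∣ X ∣ ≡ r

FamII : ∀ {n} → ℕ → ℕ → Subset n → Set
FamII r m X = InL r m X ⊎ (Level (suc r) X × ¬ InShadeL r m X)

-- Families as duplicate-free lists (the list order is the enumeration).

Enumerates : ∀ {n} → (Subset n → Set) → List (Subset n) → Set
Enumerates {n} P xs = Unique xs × ((X : Subset n) → (X LM.∈ xs) ⇔ P X)

Antichain : ∀ {n} → List (Subset n) → Set
Antichain xs = ∀ {X Y} → X LM.∈ xs → Y LM.∈ xs → X ⊆ Y → X ≡ Y

-- A_i ∩ B_j = ∅ only if i = j ≤ k  (0-based indices: i = j < k)
FewDisjointPairs : ∀ {n} → ℕ → List (Subset n) → List (Subset n) → Set
FewDisjointPairs k As Bs =
  (i : Fin (length As)) (j : Fin (length Bs)) →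
  Empty (Data.List.lookup As i ∩ Data.List.lookup Bs j) →
  (toℕ i ≡ toℕ j) × (toℕ i < k)

{-# OPTIONS --safe #-}

-- Let n = 2h. Along a decomposition of the subsets of ℕ_n into symmetric chains, the members of
-- size ≤ h of an antichain 𝒜 move up to a family a in level h, and the others move down to a family
-- in level h + 1 that avoids the shade of a. By the Kruskal–Katona theorem
-- |𝒜| ≤ C(n, h+1) − κ(|a|), and likewise |ℬ| ≤ C(n, h+1) − κ(|b|). If X ∈ a and its complement is
-- in b, then X comes from one of the first k members of 𝒜, so |a| + |b| ≤ N + k with N = C(n, h).
-- It remains to see that κ(x) + κ(y) ≥ κ(N) + κ*(k) whenever x, y ≤ N and x + y ≤ N + k. If
-- x + y = N + j with j ≥ 0, this follows from the exchange inequality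
-- f(x) + f(y) ≥ f(N) + f(j) for the shadow function f(m) = κ(m) + m, and otherwise from
-- subadditivity of f and the local LYM inequality. The exchange inequality, subadditivity and the
-- inequality behind the Kruskal–Katona theorem all follow by induction from
-- f_{r+1}(C(a, r+1) + m) = C(a, r) + f_r(m) for m ≤ C(a, r).
module Submission where

open import Defs
open import Data.Bool using (Bool; true; false; T; _∧_; _∨_; not; if_then_else_)
open import Data.Bool.Properties using (∧-zeroʳ; ∧-identityʳ; T-∨; T-∧)
open import Data.Empty using (⊥; ⊥-elim)
open import Data.Fin using (Fin; toℕ; zero; suc)
import Data.Fin.Subset
open import Data.Fin.Subset using (Subset; _⊆_; ∣_∣; Empty; _∩_; ∁)
open import Data.Fin.Subset.Properties using (out⊆; s⊆s; drop-∷-⊆; ∣p∣≤n; ∣∁p∣≡n∸∣p∣; x∈p∩q⁻; x∈∁p⇒x∉p; _⊆?_; anySubset?)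
open import Data.Integer as ℤ using (ℤ)
import Data.Integer.Properties as ℤₚ
import Data.Integer.Tactic.RingSolver as ℤ-Solver
open import Data.List as List using (List; []; _∷_; _++_; length; filter; filterᵇ; take)
open import Data.List.Membership.Propositional using (_∈_)
open import Data.List.Membership.Propositional.Properties using (∈-map⁺; ∈-map⁻; ∈-filter⁻)
open import Data.List.Properties using (length-map; length-take)
open import Data.List.Relation.Unary.All as All using ()
import Data.List.Relation.Unary.All.Properties as All
open import Data.List.Relation.Unary.AllPairs using ([]; _∷_)
open import Data.List.Relation.Unary.Any as Any using (here; there)
open import Data.List.Relation.Unary.Any.Properties using (lookup-index)
open import Data.List.Relation.Unary.Unique.Propositional using (Unique)
import Data.List.Relation.Unary.Unique.Propositional.Properties as Unique
open import Data.Nat using (ℕ; zero; suc; _+_; _*_; _∸_; _⊔_; _⊓_; _≤_; _<_; _≤ᵇ_; _<ᵇ_; _≡ᵇ_; _≤?_; _<?_; _≟_; z≤n; s≤s)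
open import Data.Nat.Combinatorics using (_C_; nCk+nC[k+1]≡[n+1]C[k+1]; nCn≡1; nC1≡n; k>n⇒nCk≡0)
open import Data.Nat.Properties hiding (_≤?_; _<?_; _≟_)
open import Data.Nat.Tactic.RingSolver using (solve-∀)
open import Data.Product using (∃; _×_; _,_; proj₁; proj₂)
open import Data.Sum using (_⊎_; inj₁; inj₂)
open import Data.Unit using (tt)
open import Data.Vec using (Vec; []; _∷_; _∷ʳ_; initLast; here; there)
open import Function using (_∘_; id)
open import Function.Bundles using (_⇔_; mk⇔; Equivalence)
open import Relation.Binary.PropositionalEquality using (_≡_; _≢_; refl; sym; trans; cong; cong₂; subst; subst₂; module ≡-Reasoning)
open import Relation.Nullary using (¬_; Dec; yes; no)
open import Relation.Nullary.Decidable using (¬?; _×-dec_; ⌊_⌋; toWitness; fromWitness)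

-- The constants fit because κ(N) = C(n, h+1) - N. Adding the bounds for 𝒜 and ℬ gives 2C(n, h+1) -
-- κ(N) - κ*(k), which is N + C(n, h+1) - κ*(k). The shadow function enters with index h although
-- shades are avoided, since complementation in ℕ_{2h} turns shades of h-sets into shadows of
-- h-sets. The exchange inequality would be immediate if f were concave, but it is not: f_2 takes
-- the values 2, 3, 3, 4 at 1, 2, 3, 4. Only an endpoint form is available, in which the pair x, y
-- is pushed to the extreme pair N, j. Its induction splits a binomial coefficient by Pascal's rule
-- into a lower block M = C(a, r+1) and an upper block K = C(a, r). A number above M continues at
-- level r, one below M stays at level r+1, so the two levels have to be compared. This is done
-- through drops of f below the top of a block.

-- Linear arithmetic and binomial coefficients.

-- The equation is gR − gL = R − L without subtraction.
linear : ∀ {L R gL gR} → L ≤ R → gR + L ≡ gL + R → gL ≤ gR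
linear {L} {R} {gL} {gR} p eq = +-cancelʳ-≤ L gL gR (begin
  gL + L  ≤⟨ +-monoʳ-≤ gL p ⟩
  gL + R  ≡⟨ sym eq ⟩
  gR + L  ∎)
  where open ≤-Reasoning

infixl 5 _⊕_
_⊕_ : ∀ {a b c d} → a ≤ b → c ≤ d → a + c ≤ b + d
_⊕_ = +-mono-≤

≤-or-> : ∀ m x → x ≤ m ⊎ ∃ λ e → x ≡ m + suc e
≤-or-> m       zero    = inj₁ z≤n
≤-or-> zero    (suc x) = inj₂ (x , refl)
≤-or-> (suc m) (suc x) with ≤-or-> m x
... | inj₁ p          = inj₁ (s≤s p)
... | inj₂ (e , refl) = inj₂ (e , refl)

complement : ∀ {d n} → d ≤ n → ∃ λ u → u + d ≡ n
complement {d} p with m≤n⇒∃[o]m+o≡n p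
... | u , eq = u , trans (+-comm u d) eq

-- B r s is the binomial coefficient C(r + s, r).
B : ℕ → ℕ → ℕ
B zero    s       = 1
B (suc r) zero    = 1
B (suc r) (suc s) = B r (suc s) + B (suc r) s

B-pos : ∀ r s → 1 ≤ B r s
B-pos zero    s       = ≤-refl
B-pos (suc r) zero    = ≤-refl
B-pos (suc r) (suc s) = ≤-trans (B-pos r (suc s)) (m≤m+n _ _)

B-zeroʳ : ∀ r → B r 0 ≡ 1
B-zeroʳ zero    = refl
B-zeroʳ (suc r) = refl

B-one : ∀ r → B r 1 ≡ suc r
B-one zero    = refl
B-one (suc r) = trans (cong (_+ 1) (B-one r)) (+-comm (suc r) 1)

B-monoˡ-+ : ∀ k r s → B r s ≤ B (k + r) s
B-monoˡ-+ zero    r s       = ≤-refl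
B-monoˡ-+ (suc k) r zero    = ≤-reflexive (B-zeroʳ r)
B-monoˡ-+ (suc k) r (suc s) = ≤-trans (B-monoˡ-+ k r (suc s)) (m≤m+n _ _)

-- Every number m lies below the block `B (suc r) m`, so a statement about all m can be proved below
-- `B (suc r) s` by induction on s.
B-large : ∀ r s → s ≤ B (suc r) s
B-large r zero    = z≤n
B-large r (suc s) = B-pos r (suc s) ⊕ B-large r s

B-oneˡ : ∀ s → B 1 s ≡ suc s
B-oneˡ zero    = refl
B-oneˡ (suc s) = cong suc (B-oneˡ s)

B-absorb : ∀ r s → B r (suc s) * suc s ≡ B (suc r) s * suc r
B-absorb zero    zero    = refl
B-absorb zero    (suc s) = trans (+-identityʳ (suc (suc s))) (trans (cong suc (sym (B-oneˡ s))) (sym (*-identityʳ (B 1 (suc s)))))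
B-absorb (suc r) zero    = trans (*-identityʳ (B (suc r) 1)) (trans (B-one (suc r)) (sym (+-identityʳ (suc (suc r)))))
B-absorb (suc r) (suc s) = begin
  (B r (suc (suc s)) + b) * suc (suc s)                ≡⟨ *-distribʳ-+ (suc (suc s)) (B r (suc (suc s))) b ⟩
  B r (suc (suc s)) * suc (suc s) + b * suc (suc s)    ≡⟨ cong (_+ b * suc (suc s)) (B-absorb r (suc s)) ⟩
  b * suc r + b * suc (suc s)                          ≡⟨ rearrange b r s ⟩
  b * suc (suc r) + b * suc s                          ≡⟨ cong (b * suc (suc r) +_) (B-absorb (suc r) s) ⟩
  b * suc (suc r) + B (suc (suc r)) s * suc (suc r)    ≡⟨ sym (*-distribʳ-+ (suc (suc r)) b (B (suc (suc r)) s)) ⟩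
  (b + B (suc (suc r)) s) * suc (suc r)                ∎
  where
  open ≡-Reasoning
  b = B (suc r) (suc s)
  rearrange : ∀ b r s → b * suc r + b * suc (suc s) ≡ b * suc (suc r) + b * suc s
  rearrange = solve-∀

-- Exchange and subadditivity of the shadow function.

module Cascade
  (f : ℕ → ℕ → ℕ)
  (f-level0 : ∀ m → f 0 m ≡ 0)
  (f-zero : ∀ r → f r 0 ≡ 0)
  -- The value `m ≡ B r (suc s)` is included although the cascade of the sum is then a single
  -- binomial coefficient. So both blocks of Pascal's rule may be full.
  (f-step : ∀ r s m → m ≤ B r (suc s) → f (suc r) (B (suc r) s + m) ≡ B r (suc s) + f r m)
  where

  f-top : ∀ r s → f (suc r) (B (suc r) s) ≡ B r (suc s)
  f-top r s = trans (cong (f (suc r)) (sym (+-identityʳ (B (suc r) s))))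
    (trans (f-step r s 0 z≤n) (trans (cong (B r (suc s) +_) (f-zero r)) (+-identityʳ (B r (suc s)))))

  f-full : ∀ r s → f (suc r) (B (suc r) (suc s)) ≡ B r (suc s) + f r (B r (suc s))
  f-full r s = trans (cong (f (suc r)) (+-comm (B r (suc s)) (B (suc r) s))) (f-step r s _ ≤-refl)

  f-one : ∀ r → f r 1 ≡ r
  f-one zero    = f-level0 1
  f-one (suc r) = trans (f-top r 0) (B-one r)

  f-mono-≤-B : ∀ r s {m n} → m ≤ n → n ≤ B r s → f r m ≤ f r n
  f-mono-≤-B zero    s {m} p q = ≤-trans (≤-reflexive (f-level0 m)) z≤n
  f-mono-≤-B (suc r) zero {n = zero} z≤n q = ≤-refl
  f-mono-≤-B (suc r) zero {n = suc zero} z≤n q = ≤-trans (≤-reflexive (f-zero (suc r))) z≤n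
  f-mono-≤-B (suc r) zero {n = suc zero} (s≤s z≤n) q = ≤-refl
  f-mono-≤-B (suc r) zero {n = suc (suc n)} p (s≤s ())
  f-mono-≤-B (suc r) (suc s) {m} {n} p q with ≤-or-> (B (suc r) s) n
  ... | inj₁ n≤M = f-mono-≤-B (suc r) s p n≤M
  ... | inj₂ (e , refl) with ≤-or-> (B (suc r) s) m
  ...   | inj₁ m≤M = begin
          f (suc r) m                         ≤⟨ f-mono-≤-B (suc r) s m≤M ≤-refl ⟩
          f (suc r) (B (suc r) s)             ≡⟨ f-top r s ⟩
          B r (suc s)                         ≤⟨ m≤m+n _ _ ⟩
          B r (suc s) + f r (suc e)           ≡⟨ sym (f-step r s (suc e) e≤K) ⟩
          f (suc r) (B (suc r) s + suc e)     ∎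
    where
    open ≤-Reasoning
    e≤K : suc e ≤ B r (suc s)
    e≤K = +-cancelʳ-≤ (B (suc r) s) _ _ (≤-trans (≤-reflexive (+-comm (suc e) (B (suc r) s))) q)
  ...   | inj₂ (d , refl) = begin
          f (suc r) (B (suc r) s + suc d)     ≡⟨ f-step r s (suc d) (≤-trans d≤e e≤K) ⟩
          B r (suc s) + f r (suc d)           ≤⟨ +-monoʳ-≤ (B r (suc s)) (f-mono-≤-B r (suc s) d≤e e≤K) ⟩
          B r (suc s) + f r (suc e)           ≡⟨ sym (f-step r s (suc e) e≤K) ⟩
          f (suc r) (B (suc r) s + suc e)     ∎
    where
    open ≤-Reasoning
    e≤K : suc e ≤ B r (suc s)
    e≤K = +-cancelʳ-≤ (B (suc r) s) _ _ (≤-trans (≤-reflexive (+-comm (suc e) (B (suc r) s))) q)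
    d≤e : suc d ≤ suc e
    d≤e = +-cancelˡ-≤ (B (suc r) s) _ _ p

  f-mono : ∀ r {m n} → m ≤ n → f r m ≤ f r n
  f-mono zero {m} p = ≤-trans (≤-reflexive (f-level0 m)) z≤n
  f-mono (suc r) {n = n} p = f-mono-≤-B (suc r) n p (B-large r n)

  -- In terms of drops: with N = `B r s`, x = N - c and y = N - d, the drop of f from N to N - (c +
  -- d) is at least the sum of the drops to x and to y.
  Exchange : ℕ → ℕ → Set
  Exchange r s = ∀ x y j → x ≤ B r s → y ≤ B r s → x + y ≡ B r s + j →
    f r (B r s) + f r j ≤ f r x + f r y

  Subadditive : ℕ → Set
  Subadditive r = ∀ x y → f r (x + y) ≤ f r x + f r y

  -- The drop f r (B r s) − f r (B r s − d) at the top of level r is monotone in r.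
  topDrop-monoˡ : ∀ k r s u v d → u + d ≡ B r s → v + d ≡ B (k + r) s →
    f r (B r s) + f (k + r) v ≤ f r u + f (k + r) (B (k + r) s)
  topDrop-monoˡ zero r s u v d p q with +-cancelʳ-≡ d u v (trans p (sym q))
  ... | refl = ≤-reflexive (+-comm (f r (B r s)) (f r u))
  topDrop-monoˡ (suc k) r zero u v d p q
    with trans p (B-zeroʳ r)
  topDrop-monoˡ (suc k) r zero zero v d p q | refl with +-cancelʳ-≡ 1 v 0 q
  ... | refl = subst (λ b → f r b + f (suc k + r) 0 ≤ f r 0 + f (suc k + r) 1) (sym (B-zeroʳ r))
         (≤-trans (≤-reflexive (cong₂ _+_ (f-one r) (f-zero (suc k + r))))
           (≤-trans (≤-reflexive (+-identityʳ r))
             (≤-trans (m≤n+m r (suc k))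
               (≤-trans (≤-reflexive (sym (f-one (suc k + r)))) (m≤n+m _ (f r 0))))))
  topDrop-monoˡ (suc k) r zero (suc zero) v zero p q | refl with trans (sym (+-identityʳ v)) q
  ... | refl = subst (λ b → f r b + f (suc k + r) 1 ≤ f r 1 + f (suc k + r) 1) (sym (B-zeroʳ r)) ≤-refl
  -- Since `d ≤ B r (suc s) ≤ K`, the drop stays inside the upper block of size K, where `f-step`
  -- turns it into a drop of level `k + r`.
  topDrop-monoˡ (suc k) r (suc s) u v d p q
    with complement (≤-trans (m≤n+m d u) (≤-trans (≤-reflexive p) (B-monoˡ-+ k r (suc s))))
  ... | w , w+d≡K = linear (topDrop-monoˡ k r (suc s) u w d p w+d≡K ⊕ ≤-reflexive e₁ ⊕ ≤-reflexive (sym (f-full (k + r) s)))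
      (rearrange (f r (B r (suc s))) (f (suc k + r) v) (f r u) (f (suc k + r) (B (suc k + r) (suc s)))
        (f (k + r) w) K (f (k + r) K))
    where
    K = B (k + r) (suc s)
    M = B (suc k + r) s
    v≡M+w : v ≡ M + w
    v≡M+w = +-cancelʳ-≡ d v (M + w) (trans q (trans (+-comm K M)
      (trans (cong (M +_) (sym w+d≡K)) (sym (+-assoc M w d)))))
    e₁ : f (suc k + r) v ≡ K + f (k + r) w
    e₁ = trans (cong (f (suc k + r)) v≡M+w)
      (f-step (k + r) s w (≤-trans (m≤m+n w d) (≤-reflexive w+d≡K)))
    rearrange : ∀ a b c e fw K fK → (c + e) + (a + fw + b + (K + fK)) ≡ (a + b) + (c + fK + (K + fw) + e)
    rearrange = solve-∀

  -- The exchange property makes the drop at the top of B R s superadditive in d, so the part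
  -- d = B r (s + 1) may be split off.
  topDrop-shift : ∀ R s → Exchange R s → ∀ r → suc r ≤ R → ∀ u v d →
    u + d ≡ B r (suc s) → v + d ≡ B R s →
    f r (B r (suc s)) + f R v ≤ f r u + f R (B R s)
  topDrop-shift R s ex zero r<R u v d p q =
    ≤-trans (≤-reflexive (cong (_+ f R v) (f-level0 1)))
      (≤-trans (f-mono R (≤-trans (m≤m+n v d) (≤-reflexive q))) (m≤n+m _ (f 0 u)))
  topDrop-shift R s ex (suc r) r<R u v d p q with ≤-or-> (B r (suc s)) d
  ... | inj₁ d≤K with complement d≤K
  ...   | w , w+d≡K = linear
          (topDrop-shift R s ex r (<⇒≤ r<R) w v d w+d≡K q
            ⊕ ≤-reflexive (f-full r s) ⊕ ≤-reflexive (sym fu))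
          (rearrange (f (suc r) (K + M)) (f R v) (f (suc r) u) (f R (B R s)) (f r w) K (f r K))
    where
    K = B r (suc s)
    M = B (suc r) s
    u≡M+w : u ≡ M + w
    u≡M+w = +-cancelʳ-≡ d u (M + w) (trans p (trans (+-comm K M)
      (trans (cong (M +_) (sym w+d≡K)) (sym (+-assoc M w d)))))
    fu : f (suc r) u ≡ K + f r w
    fu = trans (cong (f (suc r)) u≡M+w) (f-step r s w (≤-trans (m≤m+n w d) (≤-reflexive w+d≡K)))
    rearrange : ∀ a b c e fw K fK → (c + e) + (fK + b + a + (K + fw)) ≡ (a + b) + (fw + e + (K + fK) + c)
    rearrange = solve-∀
  -- Now d = K + e′ removes the whole upper block and e′ more from M. The induction hypothesis
  -- bounds the loss of K, `topDrop-monoˡ` the loss of e′, and exchange with j = v adds the two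
  -- below `B R s`.
  topDrop-shift R s ex (suc r) r<R u v d p q | inj₂ (e , refl) with complement (<⇒≤ r<R)
  ... | k , refl = linear
        (topDrop-shift R s ex r (<⇒≤ r<R) 0 (v + e′) K refl
            (trans (+-assoc v e′ K) (trans (cong (v +_) (+-comm e′ K)) q))
          ⊕ mono
          ⊕ ex (v + K) (v + e′) v
              (≤-trans (m≤m+n (v + K) e′) (≤-reflexive v+K+e′≡N))
              (≤-trans (+-monoʳ-≤ v (m≤n+m e′ K)) (≤-reflexive q))
              (trans (regroup v K e′) (cong (_+ v) q))
          ⊕ ≤-reflexive (f-full r s) ⊕ ≤-reflexive (sym (f-top r s)) ⊕ ≤-reflexive (f-zero r))
        (rearrange (f (suc r) (K + M)) (f R v) (f (suc r) u) (f R (B R s)) (f r K) (f R (v + e′)) (f R (v + K)) (f (suc r) M) K (f r 0))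
    where
    K = B r (suc s)
    M = B (suc r) s
    e′ = suc e
    v+K+e′≡N : v + K + e′ ≡ B R s
    v+K+e′≡N = trans (+-assoc v K e′) q
    regroup′ : ∀ a b c → a + (b + c) ≡ b + (a + c)
    regroup′ = solve-∀
    u+e′≡M : u + e′ ≡ M
    u+e′≡M = +-cancelˡ-≡ K (u + e′) M (trans (regroup′ K u e′) p)
    mono : f (suc r) M + f R (v + K) ≤ f (suc r) u + f R (B R s)
    mono = topDrop-monoˡ k (suc r) s u (v + K) e′ u+e′≡M v+K+e′≡N
    regroup : ∀ a b c → a + b + (a + c) ≡ a + (b + c) + a
    regroup = solve-∀
    rearrange : ∀ a b c d fK g i m K z →
      (c + d) + (fK + g + (m + i) + (d + b) + a + K + z) ≡ (a + b) + (z + d + (c + d) + (i + g) + (K + fK) + m + 0)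
    rearrange = solve-∀
 

  -- The form that exchange takes when exactly one of the two numbers reaches into the upper block:
  -- x is what it occupies there, counted at level r.
  Mixed : ℕ → ℕ → Set
  Mixed r s = ∀ x y j → x ≤ B r (suc s) → y ≤ B (suc r) s → x + y ≡ B r (suc s) + j →
    f r (B r (suc s)) + f (suc r) j ≤ f r x + f (suc r) y

  -- Put d = K - x. Then y = d + j, so d ≤ M, and the drop by d from K is at most the drop by d from
  -- M. Hence x may be replaced by v = M - d, and exchange below M applies to v and y.
  mixed : ∀ r s → Exchange (suc r) s → Mixed r s
  mixed r s ex x y j x≤K y≤M eq with complement x≤K
  ... | d , d+x≡K with complement (≤-trans (≤-trans (m≤m+n d j) (≤-reflexive (sym y≡d+j))) y≤M)
    where
    y≡d+j : y ≡ d + j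
    y≡d+j = +-cancelˡ-≡ x y (d + j) (trans eq (trans (cong (_+ j) (trans (sym d+x≡K) (+-comm d x))) (+-assoc x d j)))
  ...   | v , v+d≡M = linear
          (ex v y j (≤-trans (m≤m+n v d) (≤-reflexive v+d≡M)) y≤M v+y≡M+j
            ⊕ topDrop-shift (suc r) s ex r ≤-refl x v d (trans (+-comm x d) d+x≡K) v+d≡M)
          (rearrange (f r K) (f (suc r) j) (f r x) (f (suc r) y) (f (suc r) M) (f (suc r) v))
    where
    K = B r (suc s)
    M = B (suc r) s
    regroup : ∀ a b c d → a + b + (c + d) ≡ b + (c + (a + d))
    regroup = solve-∀
    v+y≡M+j : v + y ≡ M + j
    v+y≡M+j = +-cancelˡ-≡ x _ _ (begin
      x + (v + y)        ≡⟨ swap x v y ⟩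
      v + (x + y)        ≡⟨ cong (v +_) eq ⟩
      v + (K + j)        ≡⟨ cong (λ t → v + (t + j)) (sym d+x≡K) ⟩
      v + (d + x + j)    ≡⟨ regroup′ v d x j ⟩
      x + ((v + d) + j)  ≡⟨ cong (λ t → x + (t + j)) v+d≡M ⟩
      x + (M + j)        ∎)
      where
      open ≡-Reasoning
      swap : ∀ a b c → a + (b + c) ≡ b + (a + c)
      swap = solve-∀
      regroup′ : ∀ v d x j → v + (d + x + j) ≡ x + ((v + d) + j)
      regroup′ = solve-∀
    rearrange : ∀ fK fj fx fy fM fv →
      (fx + fy) + (fM + fj + (fK + fv)) ≡ (fK + fj) + (fv + fy + (fx + fM))
    rearrange = solve-∀

  module _ (r s : ℕ) (ex : Exchange (suc r) s) where
    private
      K = B r (suc s)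
      M = B (suc r) s

    -- Two moves: exchange below M leads from (x, y) to (M, K + j), and `mixed` with an empty upper
    -- block then carries K out of K + j into the upper block.
    exchange-low : ∀ x y j → x ≤ M → y ≤ M → x + y ≡ K + M + j →
      f (suc r) (K + M) + f (suc r) j ≤ f (suc r) x + f (suc r) y
    exchange-low x y j x≤M y≤M eq = linear
        (ex x y (K + j) x≤M y≤M eq′
          ⊕ mixed r s ex 0 (K + j) j z≤n K+j≤M refl
          ⊕ ≤-reflexive (f-full r s) ⊕ ≤-reflexive (sym (f-top r s)) ⊕ ≤-reflexive (f-zero r))
        (rearrange (f (suc r) (K + M)) (f (suc r) j) (f (suc r) x) (f (suc r) y)
          (f (suc r) M) (f (suc r) (K + j)) (f r K) K (f r 0))
      where
      regroup : ∀ a b c → a + b + c ≡ b + (a + c)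
      regroup = solve-∀
      eq′ : x + y ≡ M + (K + j)
      eq′ = trans eq (regroup K M j)
      K+j≤M : K + j ≤ M
      K+j≤M = +-cancelˡ-≤ M _ _ (≤-trans (≤-reflexive (sym eq′)) (x≤M ⊕ y≤M))
      rearrange : ∀ a fj fx fy fM fKj fK K z →
        (fx + fy) + (fM + fKj + (fK + fj) + a + K + z) ≡ (a + fj) + (fx + fy + (z + fKj) + (K + fK) + fM + 0)
      rearrange = solve-∀

    exchange-middle : ∀ x y j → x ≤ K → y ≤ M → M + x + y ≡ K + M + j →
      f (suc r) (K + M) + f (suc r) j ≤ f (suc r) (M + x) + f (suc r) y
    exchange-middle x y j x≤K y≤M eq = linear
        (mixed r s ex x y j x≤K y≤M
            (+-cancelˡ-≡ M _ _ (trans (sym (+-assoc M x y)) (trans eq (regroup K M j))))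
          ⊕ ≤-reflexive (f-full r s) ⊕ ≤-reflexive (sym (f-step r s x x≤K)))
        (rearrange (f (suc r) (K + M)) (f (suc r) j) (f (suc r) (M + x)) (f (suc r) y) (f r x) (f r K) K)
      where
      regroup : ∀ a b c → a + b + c ≡ b + (a + c)
      regroup = solve-∀
      rearrange : ∀ a fj b fy fx fK K →
        (b + fy) + (fK + fj + a + (K + fx)) ≡ (a + fj) + (fx + fy + (K + fK) + b)
      rearrange = solve-∀

    -- If the parts x and y fit together into the upper block, subadditivity merges them there and
    -- `mixed` acts on x + y and M. Otherwise j exceeds M as well, and after removing M everywhere
    -- exchange at level r remains.
    exchange-high : Exchange r (suc s) → Subadditive r → ∀ x y j → x ≤ K → y ≤ K → M + x + (M + y) ≡ K + M + j →
      f (suc r) (K + M) + f (suc r) j ≤ f (suc r) (M + x) + f (suc r) (M + y)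
    exchange-high exʳ sub x y j x≤K y≤K eq with ≤-or-> K (x + y)
    ... | inj₁ x+y≤K = linear
        (mixed r s ex (x + y) M j x+y≤K ≤-refl
            (+-cancelʳ-≡ M _ _ (trans (regroup x y M) (trans eq (regroup′ K M j))))
          ⊕ sub x y
          ⊕ ≤-reflexive (f-full r s) ⊕ ≤-reflexive (sym (f-step r s x x≤K)) ⊕ ≤-reflexive (sym (f-step r s y y≤K))
          ⊕ ≤-reflexive (f-top r s))
        (rearrange (f (suc r) (K + M)) (f (suc r) j) (f (suc r) (M + x)) (f (suc r) (M + y)) (f r x) (f r y)
          (f r K) K (f r (x + y)) (f (suc r) M))
      where
      regroup : ∀ x y M → x + y + M + M ≡ M + x + (M + y)
      regroup = solve-∀
      regroup′ : ∀ a b c → a + b + c ≡ a + c + b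
      regroup′ = solve-∀
      rearrange : ∀ a fj b c fx fy fK K fxy fM →
        (b + c) + (fK + fj + fxy + a + (K + fx) + (K + fy) + fM)
          ≡ (a + fj) + (fxy + fM + (fx + fy) + (K + fK) + b + c + K)
      rearrange = solve-∀
    ... | inj₂ (e , x+y≡K+e) = linear
        (exʳ x y e′ x≤K y≤K x+y≡K+e
          ⊕ ≤-reflexive (f-full r s) ⊕ ≤-reflexive (sym (f-step r s x x≤K)) ⊕ ≤-reflexive (sym (f-step r s y y≤K))
          ⊕ ≤-reflexive fj)
        (rearrange (f (suc r) (K + M)) (f (suc r) j) (f (suc r) (M + x)) (f (suc r) (M + y)) (f r x) (f r y)
          (f r K) K (f r e′))
      where
      e′ = suc e
      regroup : ∀ x y M → x + y + M + M ≡ M + x + (M + y)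
      regroup = solve-∀
      regroup′ : ∀ a b c → a + b + c ≡ a + c + b
      regroup′ = solve-∀
      regroup″ : ∀ K e M → K + e + M ≡ K + (M + e)
      regroup″ = solve-∀
      j≡M+e : j ≡ M + e′
      j≡M+e = +-cancelˡ-≡ K _ _ (sym (trans (sym (regroup″ K e′ M)) (trans (cong (_+ M) (sym x+y≡K+e))
        (+-cancelʳ-≡ M _ _ (trans (regroup x y M) (trans eq (regroup′ K M j)))))))
      e≤K : e′ ≤ K
      e≤K = +-cancelˡ-≤ K _ _ (≤-trans (≤-reflexive (sym x+y≡K+e)) (x≤K ⊕ y≤K))
      fj : f (suc r) j ≡ K + f r e′
      fj = trans (cong (f (suc r)) j≡M+e) (f-step r s e′ e≤K)
      rearrange : ∀ a fj b c fx fy fK K fe →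
        (b + c) + (fK + fe + a + (K + fx) + (K + fy) + fj)
          ≡ (a + fj) + (fx + fy + (K + fK) + b + c + (K + fe))
      rearrange = solve-∀

  exchange-suc : ∀ r → (∀ s → Exchange r s) → Subadditive r → ∀ s → Exchange (suc r) s
  exchange-suc r ex sub zero zero (suc zero) j x≤N y≤N eq with suc-injective eq
  ... | refl = ≤-reflexive (+-comm (f (suc r) 1) (f (suc r) 0))
  exchange-suc r ex sub zero zero (suc (suc y)) j x≤N (s≤s ()) eq
  exchange-suc r ex sub zero (suc zero) y j x≤N y≤N eq with suc-injective eq
  ... | refl = ≤-refl
  exchange-suc r ex sub zero (suc (suc x)) y j (s≤s ()) y≤N eq
  exchange-suc r ex sub (suc s) x y j x≤N y≤N eq = cases (≤-or-> M x) (≤-or-> M y)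
    where
    K = B r (suc s)
    M = B (suc r) s
    ex-s = exchange-suc r ex sub s
    ex-r = ex (suc s)
    cancel : ∀ {e} → M + e ≤ K + M → e ≤ K
    cancel p = +-cancelˡ-≤ M _ _ (≤-trans p (≤-reflexive (+-comm K M)))
    cases : x ≤ M ⊎ (∃ λ e → x ≡ M + suc e) → y ≤ M ⊎ (∃ λ e → y ≡ M + suc e) →
      f (suc r) (K + M) + f (suc r) j ≤ f (suc r) x + f (suc r) y
    cases (inj₁ x≤M)        (inj₁ y≤M)        = exchange-low r s ex-s x y j x≤M y≤M eq
    cases (inj₂ (d , refl)) (inj₁ y≤M)        = exchange-middle r s ex-s (suc d) y j (cancel x≤N) y≤M eq
    cases (inj₁ x≤M)        (inj₂ (e , refl)) =
      ≤-trans (exchange-middle r s ex-s (suc e) x j (cancel y≤N) x≤M (trans (+-comm (M + suc e) x) eq))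
        (≤-reflexive (+-comm (f (suc r) (M + suc e)) (f (suc r) x)))
    cases (inj₂ (d , refl)) (inj₂ (e , refl)) =
      exchange-high r s ex-s ex-r sub (suc d) (suc e) j (cancel x≤N) (cancel y≤N) eq

  f-≤-suc-level-top : ∀ r → Subadditive r → ∀ s → f r (B (suc r) s) ≤ B r (suc s)
  f-≤-suc-level-top r       sub zero    = ≤-trans (≤-reflexive (f-one r))
    (≤-trans (n≤1+n r) (≤-reflexive (sym (B-one r))))
  f-≤-suc-level-top zero    sub (suc s) = ≤-trans (≤-reflexive (f-level0 _)) z≤n
  f-≤-suc-level-top (suc r) sub (suc s) =
    ≤-trans (sub (B (suc r) (suc s)) (B (suc (suc r)) s))
      (≤-reflexive (f-top r (suc s)) ⊕ f-≤-suc-level-top (suc r) sub s)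

  f-≤-suc-level-≤-B : ∀ r → Subadditive r → ∀ s m → m ≤ B (suc r) s → f r m ≤ f (suc r) m
  f-≤-suc-level-≤-B r sub zero zero          m≤B = ≤-reflexive (trans (f-zero r) (sym (f-zero (suc r))))
  f-≤-suc-level-≤-B r sub zero (suc zero)    m≤B = ≤-trans (≤-reflexive (f-one r))
    (≤-trans (n≤1+n r) (≤-reflexive (sym (f-one (suc r)))))
  f-≤-suc-level-≤-B r sub zero (suc (suc m)) (s≤s ())
  f-≤-suc-level-≤-B r sub (suc s) m m≤B with ≤-or-> (B (suc r) s) m
  ... | inj₁ m≤M = f-≤-suc-level-≤-B r sub s m m≤M
  ... | inj₂ (e , refl) = begin
        f r (M + suc e)             ≤⟨ sub M (suc e) ⟩
        f r M + f r (suc e)         ≤⟨ +-monoˡ-≤ (f r (suc e)) (f-≤-suc-level-top r sub s) ⟩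
        K + f r (suc e)             ≡⟨ sym (f-step r s (suc e) e≤K) ⟩
        f (suc r) (M + suc e)       ∎
    where
    open ≤-Reasoning
    K = B r (suc s)
    M = B (suc r) s
    e≤K : suc e ≤ K
    e≤K = +-cancelˡ-≤ M _ _ (≤-trans m≤B (≤-reflexive (+-comm K M)))

  -- Needed when a sum crosses M: its remainder is counted at level r, while the summands below M
  -- are counted at level r + 1.
  f-≤-suc-level : ∀ r → Subadditive r → ∀ m → f r m ≤ f (suc r) m
  f-≤-suc-level r sub m = f-≤-suc-level-≤-B r sub m m (B-large r m)

  -- If a summand exceeds M, then M cancels and level r applies. If both are at most M but their sum
  -- is M + j, exchange pushes them to M and j, and `f (suc r) M` is K.
  subadditive-≤-B : ∀ r → Subadditive r → (∀ s → Exchange (suc r) s) → ∀ s x y →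
    x + y ≤ B (suc r) s → f (suc r) (x + y) ≤ f (suc r) x + f (suc r) y
  subadditive-≤-B r sub ex s       zero    y       le = m≤n+m _ _
  subadditive-≤-B r sub ex zero    (suc x) zero    le =
    ≤-trans (≤-reflexive (cong (f (suc r)) (+-identityʳ (suc x)))) (m≤m+n _ _)
  subadditive-≤-B r sub ex zero    (suc x) (suc y) (s≤s le) with trans (sym (+-suc x y)) (n≤0⇒n≡0 le)
  ... | ()
  subadditive-≤-B r sub ex (suc s) x@(suc _) y le with ≤-or-> (B (suc r) s) (x + y)
  ... | inj₁ x+y≤M = subadditive-≤-B r sub ex s x y x+y≤M
  ... | inj₂ (i , x+y≡M+j) = cases (≤-or-> M x) (≤-or-> M y)
    where
    K = B r (suc s)
    M = B (suc r) s
    j = suc i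
    j≤K : j ≤ K
    j≤K = +-cancelˡ-≤ M _ _ (≤-trans (≤-reflexive (sym x+y≡M+j)) (≤-trans le (≤-reflexive (+-comm K M))))
    f-x+y : f (suc r) (x + y) ≡ K + f r j
    f-x+y = trans (cong (f (suc r)) x+y≡M+j) (f-step r s j j≤K)
    high : ∀ e z → M + e + z ≡ M + j → f (suc r) (x + y) ≤ f (suc r) (M + e) + f (suc r) z
    high e z eq = begin
      f (suc r) (x + y)                 ≡⟨ f-x+y ⟩
      K + f r j                         ≡⟨ cong (λ t → K + f r t) (sym e+z≡j) ⟩
      K + f r (e + z)                   ≤⟨ +-monoʳ-≤ K (sub e z) ⟩
      K + (f r e + f r z)               ≡⟨ sym (+-assoc K (f r e) (f r z)) ⟩
      K + f r e + f r z                 ≤⟨ +-monoʳ-≤ (K + f r e) (f-≤-suc-level r sub z) ⟩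
      K + f r e + f (suc r) z           ≡⟨ cong (_+ f (suc r) z) (sym (f-step r s e (≤-trans (m≤m+n e z) (≤-trans (≤-reflexive e+z≡j) j≤K)))) ⟩
      f (suc r) (M + e) + f (suc r) z   ∎
      where
      open ≤-Reasoning
      e+z≡j : e + z ≡ j
      e+z≡j = +-cancelˡ-≡ M _ _ (trans (sym (+-assoc M e z)) eq)
    cases : x ≤ M ⊎ (∃ λ e → x ≡ M + suc e) → y ≤ M ⊎ (∃ λ e → y ≡ M + suc e) →
      f (suc r) (x + y) ≤ f (suc r) x + f (suc r) y
    cases (inj₂ (e , x≡M+e)) _ = ≤-trans (high (suc e) y (trans (cong (_+ y) (sym x≡M+e)) x+y≡M+j))
      (≤-reflexive (cong (λ t → f (suc r) t + f (suc r) y) (sym x≡M+e)))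
    cases (inj₁ _) (inj₂ (e , y≡M+e)) =
      ≤-trans (high (suc e) x (trans (cong (_+ x) (sym y≡M+e)) (trans (+-comm y x) x+y≡M+j)))
        (≤-reflexive (trans (cong (λ t → f (suc r) t + f (suc r) x) (sym y≡M+e)) (+-comm (f (suc r) y) (f (suc r) x))))
    cases (inj₁ x≤M) (inj₁ y≤M) = begin
      f (suc r) (x + y)               ≡⟨ f-x+y ⟩
      K + f r j                       ≤⟨ +-monoʳ-≤ K (f-≤-suc-level r sub j) ⟩
      K + f (suc r) j                 ≡⟨ cong (_+ f (suc r) j) (sym (f-top r s)) ⟩
      f (suc r) M + f (suc r) j       ≤⟨ ex s x y j x≤M y≤M x+y≡M+j ⟩
      f (suc r) x + f (suc r) y       ∎
      where open ≤-Reasoning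

  -- The induction is joint: exchange at level r + 1 uses subadditivity at level r, and
  -- subadditivity at level r + 1 uses exchange at level r + 1.
  exchange×subadditive : ∀ r → (∀ s → Exchange r s) × Subadditive r
  exchange×subadditive zero =
    (λ s x y j _ _ _ → ≤-trans (≤-reflexive (cong₂ _+_ (f-level0 1) (f-level0 j))) z≤n) ,
    (λ x y → ≤-trans (≤-reflexive (f-level0 (x + y))) z≤n)
  exchange×subadditive (suc r) with exchange×subadditive r
  ... | ex , sub = ex′ , λ x y → subadditive-≤-B r sub ex′ (x + y) x y (B-large r (x + y))
    where ex′ = exchange-suc r ex sub

  exchange : ∀ r s → Exchange r s
  exchange r = proj₁ (exchange×subadditive r)

  subadditive : ∀ r → Subadditive r
  subadditive r = proj₂ (exchange×subadditive r)

  -- The Eckhoff-Wegner inequality and local LYM.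

  -- The inequality of Eckhoff and Wegner: it says that joining a new point to y sets of size r,
  -- and adding x sets of size r + 1, does not beat the initial segments.
  Wegner : ℕ → Set
  Wegner r = ∀ x y → f (suc r) (x + y) ≤ (f (suc r) x ⊔ y) + f r y

  wegner-zero : Wegner 0
  wegner-zero x zero    = ≤-trans (≤-reflexive (cong (f 1) (+-identityʳ x)))
    (≤-trans (m≤m⊔n (f 1 x) 0) (m≤m+n _ _))
  wegner-zero x (suc y) = begin
    f 1 (x + suc y)                    ≤⟨ f-mono 1 (B-large 0 (x + suc y)) ⟩
    f 1 (B 1 (x + suc y))              ≡⟨ f-top 0 (x + suc y) ⟩
    1                                  ≤⟨ s≤s z≤n ⟩
    suc y                              ≤⟨ m≤n⊔m (f 1 x) (suc y) ⟩
    f 1 x ⊔ suc y                      ≤⟨ m≤m+n _ _ ⟩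
    (f 1 x ⊔ suc y) + f 0 (suc y)      ∎
    where open ≤-Reasoning

  f-suc-level-≤ : ∀ r → Wegner r → ∀ m → f (suc r) m ≤ m + f r m
  f-suc-level-≤ r w m = ≤-trans (w 0 m)
    (≤-reflexive (cong (λ t → (t ⊔ m) + f r m) (f-zero (suc r))))

  -- With x + y = M + m the left side is `K + f (suc r) m`. The entry y of the maximum suffices if y
  -- ≥ K or y ≥ K₁ + m, the entry x if x ≥ M. In the remaining case x still exceeds the next smaller
  -- block, and Pascal's rule is applied to M once more.
  wegner-≤-B : ∀ r → Wegner r → ∀ s x y → x + y ≤ B (suc (suc r)) s →
    f (suc (suc r)) (x + y) ≤ (f (suc (suc r)) x ⊔ y) + f (suc r) y
  wegner-≤-B r w s x zero le = ≤-trans (≤-reflexive (cong (f (suc (suc r))) (+-identityʳ x)))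
    (≤-trans (m≤m⊔n _ 0) (m≤m+n _ _))
  wegner-≤-B r w zero x (suc (suc y)) le =
    ⊥-elim (<⇒≱ (s≤s (s≤s z≤n)) (≤-trans (m≤n+m (suc (suc y)) x) le))
  wegner-≤-B r w zero (suc x) (suc zero) le =
    ⊥-elim (<⇒≱ (s≤s (m≤n+m 1 x)) le)
  wegner-≤-B r w zero zero (suc zero) le = begin
    f (suc (suc r)) 1                            ≡⟨ f-one (suc (suc r)) ⟩
    1 + suc r                                    ≡⟨ cong (1 +_) (sym (f-one (suc r))) ⟩
    1 + f (suc r) 1                              ≤⟨ +-monoˡ-≤ (f (suc r) 1) (m≤n⊔m (f (suc (suc r)) 0) 1) ⟩
    (f (suc (suc r)) 0 ⊔ 1) + f (suc r) 1        ∎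
    where open ≤-Reasoning
  wegner-≤-B r w (suc s) x y@(suc _) le with ≤-or-> (B (suc (suc r)) s) (x + y)
  ... | inj₁ x+y≤M = wegner-≤-B r w s x y x+y≤M
  ... | inj₂ (i , x+y≡M+m) = ≤-trans (≤-reflexive f-x+y) cases
    where
    open ≤-Reasoning
    M  = B (suc (suc r)) s
    K  = B (suc r) (suc s)
    K₁ = B (suc r) s
    K₂ = B r (suc s)
    m  = suc i
    Goal = K + f (suc r) m ≤ (f (suc (suc r)) x ⊔ y) + f (suc r) y
    m≤K : m ≤ K
    m≤K = +-cancelˡ-≤ M _ _ (≤-trans (≤-reflexive (sym x+y≡M+m)) (≤-trans le (≤-reflexive (+-comm K M))))
    f-x+y : f (suc (suc r)) (x + y) ≡ K + f (suc r) m
    f-x+y = trans (cong (f (suc (suc r))) x+y≡M+m) (f-step (suc r) s m m≤K)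
    via-y : K + f (suc r) m ≤ y + f (suc r) y → Goal
    via-y p = ≤-trans p (+-monoˡ-≤ (f (suc r) y) (m≤n⊔m (f (suc (suc r)) x) y))
    via-x : K + f (suc r) m ≤ f (suc (suc r)) x + f (suc r) y → Goal
    via-x p = ≤-trans p (+-monoˡ-≤ (f (suc r) y) (m≤m⊔n (f (suc (suc r)) x) y))

    y-large : K ≤ y → Goal
    y-large K≤y = via-y (K≤y ⊕ f-mono (suc r) (≤-trans m≤K K≤y))

    x-large : ∀ x′ → x ≡ M + x′ → Goal
    x-large x′ refl = via-x (begin
      K + f (suc r) m                                ≡⟨ cong (λ t → K + f (suc r) t) (sym x′+y≡m) ⟩
      K + f (suc r) (x′ + y)                         ≤⟨ +-monoʳ-≤ K (subadditive (suc r) x′ y) ⟩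
      K + (f (suc r) x′ + f (suc r) y)               ≡⟨ sym (+-assoc K _ _) ⟩
      K + f (suc r) x′ + f (suc r) y                 ≡⟨ cong (_+ f (suc r) y) (sym (f-step (suc r) s x′ (≤-trans (m≤m+n x′ y) (≤-trans (≤-reflexive x′+y≡m) m≤K)))) ⟩
      f (suc (suc r)) (M + x′) + f (suc r) y         ∎)
      where
      x′+y≡m : x′ + y ≡ m
      x′+y≡m = +-cancelˡ-≡ M _ _ (trans (sym (+-assoc M x′ y)) x+y≡M+m)

    -- Here m fits into K₂, so `f-step` evaluates f at K₁ + m inside K = K₂ + K₁.
    y-middle : y ≤ K → K₁ + m ≤ y → Goal
    y-middle y≤K K₁+m≤y = via-y (begin
      K + f (suc r) m                     ≤⟨ +-monoʳ-≤ K (f-suc-level-≤ r w m) ⟩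
      K + (m + f r m)                     ≡⟨ rearrange K₂ K₁ m (f r m) ⟩
      (K₁ + m) + (K₂ + f r m)             ≡⟨ cong (K₁ + m +_) (sym (f-step r s m m≤K₂)) ⟩
      (K₁ + m) + f (suc r) (K₁ + m)       ≤⟨ K₁+m≤y ⊕ f-mono (suc r) K₁+m≤y ⟩
      y + f (suc r) y                     ∎)
      where
      m≤K₂ : m ≤ K₂
      m≤K₂ = +-cancelˡ-≤ K₁ _ _ (≤-trans K₁+m≤y (≤-trans y≤K (≤-reflexive (+-comm K₂ K₁))))
      rearrange : ∀ a b c d → a + b + (c + d) ≡ b + c + (a + d)
      rearrange = solve-∀

    both-middle : x ≤ M → y ≤ K → y < K₁ + m → Goal
    both-middle = go s refl
      where
      -- Splitting s through an equation keeps M, K and K₁ in scope. For s = 0 the bound on y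
      -- already forces x ≥ 1 = M.
      go : ∀ t → t ≡ s → x ≤ M → y ≤ K → y < K₁ + m → Goal
      go zero refl x≤M y≤K y<1+m with m≤n⇒∃[o]m+o≡n (+-cancelʳ-≤ y 1 x (≤-trans y<1+m (≤-reflexive (sym x+y≡M+m))))
      ... | x′ , eq = x-large x′ (sym eq)
      go (suc t) refl x≤M y≤K y<K₁+m with x-bound
        where
        x-bound : ∃ λ x′ → x ≡ B (suc (suc r)) t + x′
        x-bound with m≤n⇒∃[o]m+o≡n {B (suc (suc r)) t} {x} (linear (<⇒≤ y<K₁+m ⊕ ≤-reflexive (sym x+y≡M+m)) (rearrange (B (suc (suc r)) t) K₁ m x y))
          where
          rearrange : ∀ M₁ K₁ m x y → x + (y + (K₁ + M₁ + m)) ≡ M₁ + (K₁ + m + (x + y))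
          rearrange = solve-∀
        ... | x′ , eq = x′ , sym eq
      ... | x′ , refl = cases (≤-or-> K₁ y)
        where
        M₁ = B (suc (suc r)) t
        x′≤K₁ : x′ ≤ K₁
        x′≤K₁ = +-cancelˡ-≤ M₁ _ _ (≤-trans x≤M (≤-reflexive (+-comm K₁ M₁)))
        x′+y≡K₁+m : x′ + y ≡ K₁ + m
        x′+y≡K₁+m = +-cancelˡ-≡ M₁ _ _ (trans (sym (+-assoc M₁ x′ y)) (trans x+y≡M+m (rearrange K₁ M₁ m)))
          where
          rearrange : ∀ a b c → a + b + c ≡ b + (a + c)
          rearrange = solve-∀
        cases : y ≤ K₁ ⊎ (∃ λ e → y ≡ K₁ + suc e) → Goal
        -- Exchange pushes x′ and y, both at most K₁, to K₁ and m.
        cases (inj₁ y≤K₁) = via-x (linear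
          (exchange (suc r) s x′ y m x′≤K₁ y≤K₁ x′+y≡K₁+m ⊕ ≤-reflexive (sym (f-top r s))
            ⊕ ≤-reflexive (sym (f-step (suc r) t x′ x′≤K₁)))
          (rearrange K₂ K₁ (f (suc r) m) (f (suc (suc r)) x) (f (suc r) y) (f (suc r) K₁) (f (suc r) x′)))
          where
          rearrange : ∀ K₂ K₁ fm fx fy fK₁ fx′ →
            (fx + fy) + (fK₁ + fm + K₂ + (K₁ + fx′)) ≡ (K₂ + K₁ + fm) + (fx′ + fy + fK₁ + fx)
          rearrange = solve-∀
        -- Now y exceeds K₁ by e′ and x′ + e′ = m. The inequality one level lower applies to x′ and
        -- e′, and adding K₁ inside the maximum restores both x and y; neither entry can be fixed
        -- beforehand.
        cases (inj₂ (e , y≡K₁+e)) = begin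
          K₂ + K₁ + f (suc r) m                                   ≡⟨ cong (λ t → K₂ + K₁ + f (suc r) t) (sym x′+e≡m) ⟩
          K₂ + K₁ + f (suc r) (x′ + e′)                           ≤⟨ +-monoʳ-≤ (K₂ + K₁) (w x′ e′) ⟩
          K₂ + K₁ + ((f (suc r) x′ ⊔ e′) + f r e′)                ≡⟨ rearrange K₂ K₁ _ _ ⟩
          (K₁ + (f (suc r) x′ ⊔ e′)) + (K₂ + f r e′)              ≡⟨ cong₂ _+_ (+-distribˡ-⊔ K₁ (f (suc r) x′) e′) (sym (f-step r s e′ e≤K₂)) ⟩
          ((K₁ + f (suc r) x′) ⊔ (K₁ + e′)) + f (suc r) (K₁ + e′) ≡⟨ cong₂ (λ a b → (a ⊔ b) + f (suc r) b) (sym (f-step (suc r) t x′ x′≤K₁)) (sym y≡K₁+e) ⟩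
          (f (suc (suc r)) (M₁ + x′) ⊔ y) + f (suc r) y           ∎
          where
          e′ = suc e
          rearrange : ∀ a b c d → a + b + (c + d) ≡ (b + c) + (a + d)
          rearrange = solve-∀
          e≤K₂ : e′ ≤ K₂
          e≤K₂ = +-cancelˡ-≤ K₁ _ _ (≤-trans (≤-reflexive (sym y≡K₁+e)) (≤-trans y≤K (≤-reflexive (+-comm K₂ K₁))))
          x′+e≡m : x′ + e′ ≡ m
          x′+e≡m = +-cancelˡ-≡ K₁ _ _ (trans (swap K₁ x′ e′) (trans (cong (x′ +_) (sym y≡K₁+e)) x′+y≡K₁+m))
            where
            swap : ∀ a b c → a + (b + c) ≡ b + (a + c)
            swap = solve-∀

    cases : Goal
    cases with ≤-or-> K y
    ... | inj₂ (e , y≡K+e) = y-large (≤-trans (m≤m+n K (suc e)) (≤-reflexive (sym y≡K+e)))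
    ... | inj₁ y≤K with ≤-or-> M x
    ...   | inj₂ (e , x≡M+e) = x-large (suc e) x≡M+e
    ...   | inj₁ x≤M with <-≤-connex y (K₁ + m)
    ...     | inj₁ y<K₁+m = both-middle x≤M y≤K y<K₁+m
    ...     | inj₂ K₁+m≤y = y-middle y≤K K₁+m≤y

  wegner : ∀ r → Wegner r
  wegner zero    = wegner-zero
  wegner (suc r) x y = wegner-≤-B r (wegner r) (x + y) x y (B-large (suc r) (x + y))

  -- The local LYM inequality |ΔF| / C(n, r − 1) ≥ |F| / C(n, r), where n = r + s.
  f-lym : ∀ r s m → m ≤ B r s → m * r ≤ f r m * suc s
  f-lym zero    s m m≤B = ≤-trans (≤-reflexive (*-zeroʳ m)) z≤n
  f-lym (suc r) zero    zero          m≤B = z≤n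
  f-lym (suc r) zero    (suc zero)    m≤B =
    ≤-reflexive (trans (+-identityʳ (suc r)) (trans (sym (f-one (suc r))) (sym (*-identityʳ (f (suc r) 1)))))
  f-lym (suc r) zero    (suc (suc m)) (s≤s ())
  f-lym (suc r) (suc s) m m≤B with ≤-or-> (B (suc r) s) m
  ... | inj₁ m≤M = ≤-trans (f-lym (suc r) s m m≤M) (*-monoʳ-≤ (f (suc r) m) (n≤1+n (suc s)))
  ... | inj₂ (e , refl) = linear
        (f-lym r (suc s) (suc e) e≤K ⊕ e≤K ⊕ ≤-reflexive (sym (B-absorb r s))
          ⊕ ≤-reflexive (cong (_* suc (suc s)) (sym (f-step r s (suc e) e≤K))))
        (rearrange M K (suc e) r s (f r (suc e)) (f (suc r) (M + suc e)))
    where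
    K = B r (suc s)
    M = B (suc r) s
    e≤K : suc e ≤ K
    e≤K = +-cancelˡ-≤ M _ _ (≤-trans m≤B (≤-reflexive (+-comm K M)))
    rearrange : ∀ M K e r s fe fm →
      fm * suc (suc s) + (e * r + e + M * suc r + (K + fe) * suc (suc s))
        ≡ (M + e) * suc r + (fe * suc (suc s) + K + K * suc s + fm * suc (suc s))
    rearrange = solve-∀

-- The Kruskal–Katona function

B≡C : ∀ r s → B r s ≡ (r + s) C r
B≡C zero    s       = refl
B≡C (suc r) zero    = sym (trans (cong (_C suc r) (+-identityʳ (suc r))) (nCn≡1 (suc r)))
B≡C (suc r) (suc s) = begin
  B r (suc s) + B (suc r) s                    ≡⟨ cong₂ _+_ (B≡C r (suc s)) (B≡C (suc r) s) ⟩
  (r + suc s) C r + (suc r + s) C suc r        ≡⟨ cong (λ t → (r + suc s) C r + t C suc r) (sym (+-suc r s)) ⟩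
  (r + suc s) C r + (r + suc s) C suc r        ≡⟨ nCk+nC[k+1]≡[n+1]C[k+1] (r + suc s) r ⟩
  (suc r + suc s) C suc r                      ∎
  where open ≡-Reasoning

B-comm : ∀ r s → B r s ≡ B s r
B-comm zero    s       = sym (B-zeroʳ s)
B-comm (suc r) zero    = refl
B-comm (suc r) (suc s) = trans (cong₂ _+_ (B-comm r (suc s)) (B-comm (suc r) s)) (+-comm (B (suc s) r) _)

C-monoˡ-suc : ∀ n k → n C k ≤ suc n C k
C-monoˡ-suc n zero    = ≤-refl
C-monoˡ-suc n (suc k) = ≤-trans (m≤n+m _ (n C k)) (≤-reflexive (nCk+nC[k+1]≡[n+1]C[k+1] n k))

C-monoˡ-≤ : ∀ k {m n} → m ≤ n → m C k ≤ n C k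
C-monoˡ-≤ k p with m≤n⇒∃[o]m+o≡n p
... | o , refl = go o
  where
  go : ∀ {m} o → m C k ≤ (m + o) C k
  go {m} zero    = ≤-reflexive (cong (_C k) (sym (+-identityʳ m)))
  go {m} (suc o) = ≤-trans (go o) (≤-trans (C-monoˡ-suc (m + o) k) (≤-reflexive (cong (_C k) (sym (+-suc m o)))))

topA-unique : ∀ r m a b → a ≤ b → a C r ≤ m → m < suc a C r → topA r m b ≡ a
topA-unique r m zero zero    a≤b lo hi = refl
topA-unique r m a    (suc b) a≤b lo hi with suc b C r ≤ᵇ m in eq
... | true with m≤n⇒m<n∨m≡n a≤b
...   | inj₁ a<b  = ⊥-elim (<⇒≱ hi (≤-trans (C-monoˡ-≤ r a<b) (≤ᵇ⇒≤ _ _ (subst T (sym eq) tt))))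
...   | inj₂ refl = refl
topA-unique r m a    (suc b) a≤b lo hi | false with m≤n⇒m<n∨m≡n a≤b
...   | inj₁ (s≤s a≤b′) = topA-unique r m a b a≤b′ lo hi
...   | inj₂ refl       = ⊥-elim (subst T eq (≤⇒≤ᵇ lo))

shadowSum-zeroʳ : ∀ r → shadowSum r 0 ≡ 0
shadowSum-zeroʳ zero    = refl
shadowSum-zeroʳ (suc r) = refl

shadowSum-greedy : ∀ r m a → 1 ≤ m → a ≤ m + suc r → a C suc r ≤ m → m < suc a C suc r →
  shadowSum (suc r) m ≡ a C r + shadowSum r (m ∸ a C suc r)
shadowSum-greedy r (suc m) a _ a≤ lo hi =
  cong (λ a → a C r + shadowSum r (suc m ∸ a C suc r)) (topA-unique (suc r) (suc m) a _ a≤ lo hi)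

shadowSum-step-< : ∀ r s m → m < B r (suc s) →
  shadowSum (suc r) (B (suc r) s + m) ≡ B r (suc s) + shadowSum r m
shadowSum-step-< r s m m<K = trans
  (shadowSum-greedy r (B (suc r) s + m) a (≤-trans (B-pos (suc r) s) (m≤m+n _ _))
    -- The greedy search starts at the number represented plus `suc r`; `B-large` shows that a does
    -- not lie beyond this start.
    (≤-trans (≤-reflexive (+-comm (suc r) s)) (+-monoˡ-≤ (suc r) (≤-trans (B-large r s) (m≤m+n _ m))))
    (≤-trans (≤-reflexive (sym M≡)) (m≤m+n _ m))
    (≤-trans (≤-reflexive (sym (+-suc _ m))) (≤-trans (+-monoʳ-≤ _ m<K)
      (≤-reflexive (trans (+-comm (B (suc r) s) (B r (suc s))) (trans (B≡C (suc r) (suc s)) (cong (_C suc r) (cong suc (+-suc r s)))))))))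
  (cong₂ _+_ (sym K≡) (cong (shadowSum r) (trans (cong (B (suc r) s + m ∸_) (sym M≡)) (m+n∸m≡n (B (suc r) s) m))))
  where
  a = suc r + s
  M≡ : B (suc r) s ≡ a C suc r
  M≡ = B≡C (suc r) s
  K≡ : B r (suc s) ≡ a C r
  K≡ = trans (B≡C r (suc s)) (cong (_C r) (+-suc r s))

shadowSum-top : ∀ r s → shadowSum (suc r) (B (suc r) s) ≡ B r (suc s)
shadowSum-top r s = trans (cong (shadowSum (suc r)) (sym (+-identityʳ (B (suc r) s))))
  (trans (shadowSum-step-< r s 0 (B-pos r (suc s))) (trans (cong (B r (suc s) +_) (shadowSum-zeroʳ r)) (+-identityʳ _)))

-- At m = K the greedy choice jumps to the next binomial coefficient, and Pascal's rule shows that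
-- the shadow size is still the sum of the two parts.
shadowSum-step : ∀ r s m → m ≤ B r (suc s) →
  shadowSum (suc r) (B (suc r) s + m) ≡ B r (suc s) + shadowSum r m
shadowSum-step r s m m≤K with m≤n⇒m<n∨m≡n m≤K
... | inj₁ m<K  = shadowSum-step-< r s m m<K
... | inj₂ refl = trans (cong (shadowSum (suc r)) (+-comm (B (suc r) s) _)) (trans (shadowSum-top r (suc s)) (pascal r))
  where
  pascal : ∀ r → B r (suc (suc s)) ≡ B r (suc s) + shadowSum r (B r (suc s))
  pascal zero    = refl
  pascal (suc r) = trans (+-comm _ (B (suc r) (suc s))) (cong (B (suc r) (suc s) +_) (sym (shadowSum-top r (suc s))))

open Cascade shadowSum (λ _ → refl) shadowSum-zeroʳ shadowSum-step public

-- The threshold and the sign of κ*.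

sumT-suc : ∀ h → sumT (suc h) ≡ B (suc h) h + sumT h
sumT-suc h = trans (+-comm (sumT h) _) (cong (_+ sumT h)
  (trans (cong (λ t → suc (h + t) C suc h) (+-identityʳ h)) (sym (B≡C (suc h) h))))

threshold-≤ : ∀ h → threshold h ≤ B h (suc h)
threshold-≤ zero    = ≤-refl
threshold-≤ (suc h) = begin
  suc (sumT (suc h))                    ≡⟨ cong suc (sumT-suc h) ⟩
  suc (B (suc h) h + sumT h)            ≡⟨ sym (+-suc (B (suc h) h) (sumT h)) ⟩
  B (suc h) h + threshold h             ≤⟨ +-monoʳ-≤ (B (suc h) h) (threshold-≤ h) ⟩
  B (suc h) h + B h (suc h)             ≡⟨ +-comm (B (suc h) h) _ ⟩
  B (suc h) (suc h)                     ≤⟨ m≤n+m _ (B h (suc (suc h))) ⟩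
  B (suc h) (suc (suc h))               ∎
  where open ≤-Reasoning

-- Each block C(2i - 1, i) has a shadow of the same size C(2i - 1, i - 1). Only the extra unit is
-- lost: it is left over at level 0, where the shadow is 0.
shadowSum-threshold : ∀ h → shadowSum h (threshold h) ≡ sumT h
shadowSum-threshold zero    = refl
shadowSum-threshold (suc h) = begin
  shadowSum (suc h) (suc (sumT (suc h)))           ≡⟨ cong (λ t → shadowSum (suc h) (suc t)) (sumT-suc h) ⟩
  shadowSum (suc h) (suc (B (suc h) h + sumT h))   ≡⟨ cong (shadowSum (suc h)) (sym (+-suc (B (suc h) h) (sumT h))) ⟩
  shadowSum (suc h) (B (suc h) h + threshold h)    ≡⟨ shadowSum-step h h (threshold h) (threshold-≤ h) ⟩
  B h (suc h) + shadowSum h (threshold h)          ≡⟨ cong₂ _+_ (B-comm h (suc h)) (shadowSum-threshold h) ⟩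
  B (suc h) h + sumT h                             ≡⟨ sym (sumT-suc h) ⟩
  sumT (suc h)                                     ∎
  where open ≡-Reasoning

-- Up to `B (suc h) h` the two factors in local LYM are equal. Removing this block lowers m and its
-- shadow by the same amount.
m≤shadowSum : ∀ h m → m ≤ sumT h → m ≤ shadowSum h m
m≤shadowSum zero    m m≤T = m≤T
m≤shadowSum (suc h) m m≤T with ≤-or-> (B (suc h) h) m
... | inj₁ m≤M          = *-cancelʳ-≤ m _ (suc h) (f-lym (suc h) h m m≤M)
... | inj₂ (e , refl)   = begin
  M + suc e                            ≤⟨ ≤-reflexive (B-comm (suc h) h) ⊕ m≤shadowSum h (suc e) e≤T ⟩
  B h (suc h) + shadowSum h (suc e)    ≡⟨ sym (shadowSum-step h h (suc e) (≤-trans e≤T (≤-trans (n≤1+n _) (threshold-≤ h)))) ⟩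
  shadowSum (suc h) (M + suc e)        ∎
  where
  open ≤-Reasoning
  M = B (suc h) h
  e≤T : suc e ≤ sumT h
  e≤T = +-cancelˡ-≤ M _ _ (≤-trans m≤T (≤-reflexive (sumT-suc h)))

κ*≤κ : ∀ r {j k} → j ≤ k → κ* r k ℤ.≤ κ r j
κ*≤κ r {zero} {zero}  z≤n = ℤₚ.≤-refl
κ*≤κ r {j}    {suc k} p with m≤n⇒m<n∨m≡n p
... | inj₁ (s≤s j≤k) = ℤₚ.≤-trans (ℤₚ.i⊓j≤i (κ* r k) _) (κ*≤κ r j≤k)
... | inj₂ refl      = ℤₚ.i⊓j≤j (κ* r k) _

κ*-glb : ∀ r k {z} → (∀ j → j ≤ k → z ℤ.≤ κ r j) → z ℤ.≤ κ* r k
κ*-glb r zero    p = p 0 z≤n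
κ*-glb r (suc k) p = ℤₚ.⊓-glb (κ*-glb r k (λ j j≤k → p j (m≤n⇒m≤1+n j≤k))) (p (suc k) ≤-refl)

κ-zero : ∀ r → κ r 0 ≡ ℤ.+ 0
κ-zero r rewrite shadowSum-zeroʳ r = refl

κ*≤0 : ∀ r k → κ* r k ℤ.≤ ℤ.+ 0
κ*≤0 r k = ℤₚ.≤-trans (κ*≤κ r {0} {k} z≤n) (ℤₚ.≤-reflexive (κ-zero r))

κ*-below-threshold : ∀ h k → k < threshold h → κ* h k ≡ ℤ.+ 0
κ*-below-threshold h k (s≤s k≤T) = ℤₚ.≤-antisym (κ*≤0 h k)
  (κ*-glb h k (λ j j≤k → ℤₚ.i≤j⇒0≤j-i (ℤ.+≤+ (m≤shadowSum h j (≤-trans j≤k k≤T)))))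

κ*-above-threshold : ∀ h k → threshold h ≤ k → κ* h k ℤ.< ℤ.+ 0
κ*-above-threshold h k p = ℤₚ.≤-<-trans (κ*≤κ h p)
  (ℤₚ.<-≤-trans (ℤₚ.+-monoˡ-< (ℤ.- (ℤ.+ threshold h)) (ℤ.+<+ (s≤s (≤-reflexive (shadowSum-threshold h)))))
    (ℤₚ.≤-reflexive (ℤₚ.+-inverseʳ (ℤ.+ threshold h))))

-- The numerical bound for two families.

-- This is κ(N) ≤ κ(m). Local LYM gives m - f(m) ≤ m / (h + 1), which is at most N / (h + 1) = N -
-- f(N).
middle-drop : ∀ h m → m ≤ B h h → shadowSum h (B h h) + m ≤ B h h + shadowSum h m
middle-drop zero    m p = ≤-trans p (m≤m+n 1 0)
middle-drop (suc h) m p = *-cancelʳ-≤ _ _ (suc (suc h)) (linear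
      (f-lym (suc h) (suc h) m p ⊕ p ⊕ ≤-reflexive absorb)
      (rearrange (B (suc h) (suc h)) (shadowSum (suc h) (B (suc h) (suc h))) m (shadowSum (suc h) m) h))
  where
  absorb : shadowSum (suc h) (B (suc h) (suc h)) * suc (suc h) ≡ B (suc h) (suc h) * suc h
  absorb = trans (cong (_* suc (suc h)) (shadowSum-top h (suc h))) (B-absorb h (suc h))
  rearrange : ∀ N E m fm h → (N + fm) * suc (suc h) + (m * suc h + m + E * suc (suc h))
    ≡ (E + m) * suc (suc h) + (fm * suc (suc h) + N + N * suc h)
  rearrange = solve-∀

-- Here `shadowSum h (B h h)` stands for C(2h, h + 1), and j is the excess of x + y over `B h h`, or
-- 0 if there is none.
κ-bound : ∀ h x y k a b → x ≤ B h h → y ≤ B h h → x + y ≤ B h h + k →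
  a + shadowSum h x ≤ x + shadowSum h (B h h) → b + shadowSum h y ≤ y + shadowSum h (B h h) →
  ∃ λ j → j ≤ k × a + b + shadowSum h j ≤ B h h + shadowSum h (B h h) + j
κ-bound h x y k a b x≤N y≤N x+y≤N+k pa pb with ≤-or-> (B h h) (x + y)
-- Without excess, κ(x) + κ(y) ≥ κ(x + y) ≥ κ(N) by subadditivity and `middle-drop`.
... | inj₁ x+y≤N = 0 , z≤n , linear
      (pa ⊕ pb ⊕ subadditive h x y ⊕ middle-drop h (x + y) x+y≤N ⊕ ≤-reflexive (shadowSum-zeroʳ h))
      (rearrange (B h h) (shadowSum h (B h h)) a b x y (shadowSum h x) (shadowSum h y) (shadowSum h (x + y)) (shadowSum h 0))
  where
  rearrange : ∀ N E a b x y fx fy fs f0 →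
    (N + E + 0) + (a + fx + (b + fy) + fs + (E + (x + y)) + f0)
      ≡ (a + b + f0) + (x + E + (y + E) + (fx + fy) + (N + fs) + 0)
  rearrange = solve-∀
... | inj₂ (e , x+y≡N+j) = suc e , +-cancelˡ-≤ (B h h) _ _ (≤-trans (≤-reflexive (sym x+y≡N+j)) x+y≤N+k) , linear
      (pa ⊕ pb ⊕ exchange h h x y (suc e) x≤N y≤N x+y≡N+j ⊕ ≤-reflexive x+y≡N+j)
      (rearrange (B h h) (shadowSum h (B h h)) a b x y (shadowSum h x) (shadowSum h y) (shadowSum h (suc e)) (suc e))
  where
  rearrange : ∀ N E a b x y fx fy fj j →
    (N + E + j) + (a + fx + (b + fy) + (E + fj) + (x + y))
      ≡ (a + b + fj) + (x + E + (y + E) + (fx + fy) + (N + j))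
  rearrange = solve-∀

ℕ-sum⇒ℤ : ∀ a n f j → a + f ≡ n + j → ℤ.+ a ≡ ℤ.+ n ℤ.- (ℤ.+ f ℤ.- ℤ.+ j)
ℕ-sum⇒ℤ a n f j p = trans (cancel (ℤ.+ a) (ℤ.+ f))
  (trans (cong (λ t → ℤ.+ t ℤ.- ℤ.+ f) p) (rearrange (ℤ.+ n) (ℤ.+ f) (ℤ.+ j)))
  where
  cancel : ∀ a f → a ≡ a ℤ.+ f ℤ.- f
  cancel = ℤ-Solver.solve-∀
  rearrange : ∀ n f j → n ℤ.+ j ℤ.- f ≡ n ℤ.- (f ℤ.- j)
  rearrange = ℤ-Solver.solve-∀

ℕ-bound⇒ℤ : ∀ a n f j → a + f ≤ n + j → ℤ.+ a ℤ.≤ ℤ.+ n ℤ.- (ℤ.+ f ℤ.- ℤ.+ j)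
ℕ-bound⇒ℤ a n f j p with m≤n⇒∃[o]m+o≡n p
... | o , eq = ℤₚ.≤-trans (ℤ.+≤+ (m≤m+n a o))
  (ℤₚ.≤-reflexive (ℕ-sum⇒ℤ (a + o) n f j (trans (trans (+-assoc a o f) (trans (cong (a +_) (+-comm o f)) (sym (+-assoc a f o)))) eq)))

-- Families of subsets

-- As Boolean functions, families restrict to the sets with or without a given end element by
-- composition, which is how the inductions below split them.
Family : ℕ → Set
Family n = Subset n → Bool

card : ∀ {n} → Family n → ℕ
card {zero}  P = if P [] then 1 else 0
card {suc n} P = card (P ∘ (false ∷_)) + card (P ∘ (true ∷_))

level : ∀ {n} → ℕ → Family n
level q X = ∣ X ∣ ≡ᵇ q

_∩ᶠ_ _∪ᶠ_ : ∀ {n} → Family n → Family n → Family n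
(P ∩ᶠ Q) X = P X ∧ Q X
(P ∪ᶠ Q) X = P X ∨ Q X

card-mono : ∀ {n} {P Q : Family n} → (∀ X → T (P X) → T (Q X)) → card P ≤ card Q
card-mono {zero} {P} {Q} P⊆Q with P [] | Q [] | P⊆Q []
... | false | _     | _ = z≤n
... | true  | true  | _ = ≤-refl
... | true  | false | p = ⊥-elim (p tt)
card-mono {suc n} P⊆Q = card-mono (λ X → P⊆Q (false ∷ X)) ⊕ card-mono (λ X → P⊆Q (true ∷ X))

card-cong : ∀ {n} {P Q : Family n} → (∀ X → T (P X) → T (Q X)) → (∀ X → T (Q X) → T (P X)) → card P ≡ card Q
card-cong P⊆Q Q⊆P = ≤-antisym (card-mono P⊆Q) (card-mono Q⊆P)

card-empty : ∀ n → card {n} (λ _ → false) ≡ 0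
card-empty zero    = refl
card-empty (suc n) = cong₂ _+_ (card-empty n) (card-empty n)

card-none : ∀ {n} {P : Family n} → (∀ X → ¬ T (P X)) → card P ≡ 0
card-none {n} ¬P = trans (card-cong ¬P (λ _ ())) (card-empty n)

card-∪-∩ : ∀ {n} (P Q : Family n) → card P + card Q ≡ card (P ∪ᶠ Q) + card (P ∩ᶠ Q)
card-∪-∩ {zero} P Q with P [] | Q []
... | false | false = refl
... | false | true  = refl
... | true  | false = refl
... | true  | true  = refl
card-∪-∩ {suc n} P Q = begin
  p₀ + p₁ + (q₀ + q₁)    ≡⟨ rearrange p₀ p₁ q₀ q₁ ⟩
  (p₀ + q₀) + (p₁ + q₁)  ≡⟨ cong₂ _+_ (card-∪-∩ (P ∘ (false ∷_)) (Q ∘ (false ∷_))) (card-∪-∩ (P ∘ (true ∷_)) (Q ∘ (true ∷_))) ⟩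
  u₀ + i₀ + (u₁ + i₁)    ≡⟨ rearrange u₀ i₀ u₁ i₁ ⟩
  card (P ∪ᶠ Q) + card (P ∩ᶠ Q)  ∎
  where
  open ≡-Reasoning
  p₀ = card (P ∘ (false ∷_))
  p₁ = card (P ∘ (true ∷_))
  q₀ = card (Q ∘ (false ∷_))
  q₁ = card (Q ∘ (true ∷_))
  u₀ = card ((P ∪ᶠ Q) ∘ (false ∷_))
  u₁ = card ((P ∪ᶠ Q) ∘ (true ∷_))
  i₀ = card ((P ∩ᶠ Q) ∘ (false ∷_))
  i₁ = card ((P ∩ᶠ Q) ∘ (true ∷_))
  rearrange : ∀ a b c d → a + b + (c + d) ≡ a + c + (b + d)
  rearrange = solve-∀

card-∪-disjoint : ∀ {n} (P Q : Family n) → (∀ X → T (P X) → T (Q X) → ⊥) → card (P ∪ᶠ Q) ≡ card P + card Q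
card-∪-disjoint P Q dis = sym (trans (card-∪-∩ P Q) (trans
  (cong (card (P ∪ᶠ Q) +_) (card-none (λ X PQ → let p , q = Equivalence.to T-∧ PQ in dis X p q)))
  (+-identityʳ _)))

card-∁ : ∀ {n} (P : Family n) → card (P ∘ ∁) ≡ card P
card-∁ {zero}  P = refl
card-∁ {suc n} P = trans (cong₂ _+_ (card-∁ (P ∘ (true ∷_))) (card-∁ (P ∘ (false ∷_)))) (+-comm _ (card (P ∘ (false ∷_))))

card-level : ∀ n q → card {n} (level q) ≡ n C q
card-level zero    zero    = refl
card-level zero    (suc q) = refl
card-level (suc n) zero    = cong₂ _+_ (card-level n 0) (card-empty n)
card-level (suc n) (suc q) = trans (+-comm (card {n} (level (suc q))) _)
  (trans (cong₂ _+_ (card-level n q) (card-level n (suc q))) (nCk+nC[k+1]≡[n+1]C[k+1] n q))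

card-≤-level : ∀ {n} q {P : Family n} → (∀ X → T (P X) → ∣ X ∣ ≡ q) → card P ≤ n C q
card-≤-level {n} q Pq = ≤-trans (card-mono (λ X p → ≡⇒≡ᵇ ∣ X ∣ q (Pq X p))) (≤-reflexive (card-level n q))

eqᵇ⇒≡ : ∀ {n} (X Y : Subset n) → T (eqᵇ X Y) → X ≡ Y
eqᵇ⇒≡ []          []          _ = refl
eqᵇ⇒≡ (true ∷ X)  (true ∷ Y)  p = cong (true ∷_) (eqᵇ⇒≡ X Y p)
eqᵇ⇒≡ (false ∷ X) (false ∷ Y) p = cong (false ∷_) (eqᵇ⇒≡ X Y p)

eqᵇ-refl : ∀ {n} (X : Subset n) → T (eqᵇ X X)
eqᵇ-refl []          = tt
eqᵇ-refl (true ∷ X)  = eqᵇ-refl X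
eqᵇ-refl (false ∷ X) = eqᵇ-refl X

card-singleton : ∀ {n} (X : Subset n) → card (eqᵇ X) ≡ 1
card-singleton []                  = refl
card-singleton {suc n} (true ∷ X)  = cong₂ _+_ (card-empty n) (card-singleton X)
card-singleton {suc n} (false ∷ X) = cong₂ _+_ (card-singleton X) (card-empty n)

members : ∀ {n} → List (Subset n) → Family n
members []       Y = false
members (X ∷ Xs) Y = eqᵇ X Y ∨ members Xs Y

members⁺ : ∀ {n} {Y : Subset n} {Xs} → Y ∈ Xs → T (members Xs Y)
members⁺ {Y = Y} (here refl) = Equivalence.from T-∨ (inj₁ (eqᵇ-refl Y))
members⁺         (there p)   = Equivalence.from T-∨ (inj₂ (members⁺ p))

members⁻ : ∀ {n} (Xs : List (Subset n)) {Y} → T (members Xs Y) → Y ∈ Xs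
members⁻ (X ∷ Xs) {Y} p with Equivalence.to (T-∨ {eqᵇ X Y}) p
... | inj₁ q = here (sym (eqᵇ⇒≡ X Y q))
... | inj₂ q = there (members⁻ Xs q)

card-members-≤ : ∀ {n} (Xs : List (Subset n)) → card (members Xs) ≤ length Xs
card-members-≤ {n} []   = ≤-reflexive (card-empty n)
card-members-≤ (X ∷ Xs) = ≤-trans (≤-trans (m≤m+n _ _) (≤-reflexive (sym (card-∪-∩ (eqᵇ X) (members Xs)))))
  (≤-reflexive (card-singleton X) ⊕ card-members-≤ Xs)

card-members : ∀ {n} {Xs : List (Subset n)} → Unique Xs → card (members Xs) ≡ length Xs
card-members {n} []               = card-empty n
card-members {Xs = X ∷ Xs} (X∉Xs ∷ u) = trans
  (card-∪-disjoint (eqᵇ X) (members Xs) (λ Y X≡Y Y∈Xs → All.lookup X∉Xs (members⁻ Xs Y∈Xs) (eqᵇ⇒≡ X Y X≡Y)))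
  (cong₂ _+_ (card-singleton X) (card-members u))

enumerates-length : ∀ {n} {P : Subset n → Set} (F : Family n) → (∀ X → T (F X) → P X) → (∀ X → P X → T (F X)) →
  ∀ {Xs} → Enumerates P Xs → length Xs ≡ card F
enumerates-length F F⇒P P⇒F {Xs} (u , e) = trans (sym (card-members u))
  (card-cong (λ X X∈ → P⇒F X (Equivalence.to (e X) (members⁻ Xs X∈))) (λ X FX → members⁺ (Equivalence.from (e X) (F⇒P X FX))))

-- The Kruskal-Katona theorem for shades.

-- D avoids the shade of a. Splitting both families at the first element, the sets of a without
-- it and the links of D at it are disjoint in level q, and wegner adds up the three bounds.
kruskal-katona : ∀ n p q → p + q ≡ n → (a D : Family n) →
  (∀ X → T (a X) → ∣ X ∣ ≡ q) → (∀ X → T (D X) → ∣ X ∣ ≡ suc q) →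
  (∀ X Y → T (a X) → T (D Y) → ¬ X ⊆ Y) →
  shadowSum p (card a) + card D ≤ n C suc q
kruskal-katona n       zero    q       eq a D aq Dq free = card-≤-level (suc q) Dq
kruskal-katona (suc n) (suc p) q eq a D aq Dq free = begin
  shadowSum (suc p) (card a₀ + card a₁) + (card D₀ + card D₁)
    ≡⟨ cong (λ t → shadowSum (suc p) t + (card D₀ + card D₁)) (+-comm (card a₀) (card a₁)) ⟩
  shadowSum (suc p) (card a₁ + card a₀) + (card D₀ + card D₁)
    ≤⟨ +-monoˡ-≤ _ (wegner p (card a₁) (card a₀)) ⟩
  (shadowSum (suc p) (card a₁) ⊔ card a₀) + shadowSum p (card a₀) + (card D₀ + card D₁)
    ≡⟨ rearrange (shadowSum (suc p) (card a₁) ⊔ card a₀) (shadowSum p (card a₀)) (card D₀) (card D₁) ⟩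
  ((shadowSum (suc p) (card a₁) ⊔ card a₀) + card D₁) + (shadowSum p (card a₀) + card D₀)
    ≡⟨ cong (_+ (shadowSum p (card a₀) + card D₀)) (+-distribʳ-⊔ (card D₁) (shadowSum (suc p) (card a₁)) (card a₀)) ⟩
  ((shadowSum (suc p) (card a₁) + card D₁) ⊔ (card a₀ + card D₁)) + (shadowSum p (card a₀) + card D₀)
    ≤⟨ ⊔-lub (upper q eq aq Dq) middle ⊕ lower ⟩
  n C q + n C suc q
    ≡⟨ nCk+nC[k+1]≡[n+1]C[k+1] n q ⟩
  suc n C suc q ∎
  where
  open ≤-Reasoning
  a₀ = a ∘ (false ∷_)
  a₁ = a ∘ (true ∷_)
  D₀ = D ∘ (false ∷_)
  D₁ = D ∘ (true ∷_)
  rearrange : ∀ a b c d → a + b + (c + d) ≡ (a + d) + (b + c)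
  rearrange = solve-∀
  lower : shadowSum p (card a₀) + card D₀ ≤ n C suc q
  lower = kruskal-katona n p q (suc-injective eq) a₀ D₀ (aq ∘ (false ∷_)) (Dq ∘ (false ∷_))
    (λ X Y aX DY X⊆Y → free (false ∷ X) (false ∷ Y) aX DY (s⊆s X⊆Y))
  middle : card a₀ + card D₁ ≤ n C q
  middle = ≤-trans (≤-reflexive (sym (card-∪-disjoint a₀ D₁ (λ X aX DX → free (false ∷ X) (true ∷ X) aX DX (out⊆ id)))))
    (card-≤-level q (λ X aD → case (Equivalence.to (T-∨ {a₀ X}) aD)))
    where
    case : ∀ {X} → T (a₀ X) ⊎ T (D₁ X) → ∣ X ∣ ≡ q
    case {X} (inj₁ aX) = aq (false ∷ X) aX
    case {X} (inj₂ DX) = suc-injective (Dq (true ∷ X) DX)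
  upper : ∀ q → suc p + q ≡ suc n → (∀ X → T (a X) → ∣ X ∣ ≡ q) → (∀ X → T (D X) → ∣ X ∣ ≡ suc q) →
    shadowSum (suc p) (card a₁) + card D₁ ≤ n C q
  upper zero    eq aq Dq = begin
    shadowSum (suc p) (card a₁) + card D₁   ≡⟨ cong (λ t → shadowSum (suc p) t + card D₁) (card-none (λ X aX → 1+n≢0 (aq (true ∷ X) aX))) ⟩
    card D₁                                 ≤⟨ card-≤-level 0 (λ X DX → suc-injective (Dq (true ∷ X) DX)) ⟩
    n C 0                                   ∎
  upper (suc q) eq aq Dq = kruskal-katona n (suc p) q (trans (sym (+-suc p q)) (suc-injective eq)) a₁ D₁
    (λ X aX → suc-injective (aq (true ∷ X) aX)) (λ X DX → suc-injective (Dq (true ∷ X) DX))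
    (λ X Y aX DY X⊆Y → free (true ∷ X) (true ∷ Y) aX DY (s⊆s X⊆Y))

-- Symmetric chains

-- Bracketing: reading outside as "(" and inside as ")", the matched positions of a subset and its
-- number of unmatched ")" determine it, and letting the latter vary runs through a symmetric chain.
data Mark : Set where
  open′ close′ free : Mark

-- The first t free positions are the unmatched ")"; they precede every unmatched "(".
fill : ∀ {n} → Vec Mark n → ℕ → Subset n
fill []           t       = []
fill (open′ ∷ p)  t       = false ∷ fill p t
fill (close′ ∷ p) t       = true ∷ fill p t
fill (free ∷ p)   zero    = false ∷ fill p zero
fill (free ∷ p)   (suc t) = true ∷ fill p t

frees : ∀ {n} → Vec Mark n → ℕ
frees []           = 0
frees (open′ ∷ p)  = frees p
frees (close′ ∷ p) = frees p
frees (free ∷ p)   = suc (frees p)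

closes : ∀ {n} → Vec Mark n → ℕ
closes []           = 0
closes (open′ ∷ p)  = closes p
closes (close′ ∷ p) = suc (closes p)
closes (free ∷ p)   = closes p

closeFirst : ∀ {n} → Vec Mark n → Vec Mark n
closeFirst []           = []
closeFirst (open′ ∷ p)  = open′ ∷ closeFirst p
closeFirst (close′ ∷ p) = close′ ∷ closeFirst p
closeFirst (free ∷ p)   = close′ ∷ p

-- A new "(" in front is matched with the nearest unmatched ")", which is the first free position,
-- and stays free if t = 0.
pushFalse : ∀ {n} → Vec Mark n × ℕ → Vec Mark (suc n) × ℕ
pushFalse (p , zero)  = free ∷ p , zero
pushFalse (p , suc t) = open′ ∷ closeFirst p , t

pushTrue : ∀ {n} → Vec Mark n × ℕ → Vec Mark (suc n) × ℕ
pushTrue (p , t) = free ∷ p , suc t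

bracket : ∀ {n} → Subset n → Vec Mark n × ℕ
bracket []          = [] , 0
bracket (false ∷ X) = pushFalse (bracket X)
bracket (true ∷ X)  = pushTrue (bracket X)

fill-closeFirst : ∀ {n} (p : Vec Mark n) t → 1 ≤ frees p → fill (closeFirst p) t ≡ fill p (suc t)
fill-closeFirst (open′ ∷ p)  t le = cong (false ∷_) (fill-closeFirst p t le)
fill-closeFirst (close′ ∷ p) t le = cong (true ∷_) (fill-closeFirst p t le)
fill-closeFirst (free ∷ p)   t le = refl

frees-closeFirst : ∀ {n} (p : Vec Mark n) → 1 ≤ frees p → suc (frees (closeFirst p)) ≡ frees p
frees-closeFirst (open′ ∷ p)  le = frees-closeFirst p le
frees-closeFirst (close′ ∷ p) le = frees-closeFirst p le
frees-closeFirst (free ∷ p)   le = refl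

closes-closeFirst : ∀ {n} (p : Vec Mark n) → 1 ≤ frees p → closes (closeFirst p) ≡ suc (closes p)
closes-closeFirst (open′ ∷ p)  le = closes-closeFirst p le
closes-closeFirst (close′ ∷ p) le = cong suc (closes-closeFirst p le)
closes-closeFirst (free ∷ p)   le = refl

fill-mono : ∀ {n} (p : Vec Mark n) {t u} → t ≤ u → fill p t ⊆ fill p u
fill-mono (open′ ∷ p)  le        = s⊆s (fill-mono p le)
fill-mono (close′ ∷ p) le        = s⊆s (fill-mono p le)
fill-mono (free ∷ p)   {u = zero}  z≤n = id
fill-mono (free ∷ p)   {u = suc u} z≤n = out⊆ (fill-mono p z≤n)
fill-mono (free ∷ p)   (s≤s le)  = s⊆s (fill-mono p le)
fill-mono []           le        = id

∣fill∣ : ∀ {n} (p : Vec Mark n) {t} → t ≤ frees p → ∣ fill p t ∣ ≡ closes p + t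
∣fill∣ []           z≤n      = refl
∣fill∣ (open′ ∷ p)  le       = ∣fill∣ p le
∣fill∣ (close′ ∷ p) le       = cong suc (∣fill∣ p le)
∣fill∣ (free ∷ p)   {zero}  z≤n = ∣fill∣ p z≤n
∣fill∣ (free ∷ p)   (s≤s le) = trans (cong suc (∣fill∣ p le)) (sym (+-suc (closes p) _))

record IsBracketing {n} (X : Subset n) (p : Vec Mark n) (t : ℕ) : Set where
  field
    t≤frees  : t ≤ frees p
    fill≡    : fill p t ≡ X
    -- Opening and closing marks are equally many; this makes the chain symmetric about the middle
    -- level.
    balanced : closes p + closes p + frees p ≡ n
    -- The pattern is constant along the chain, so any member of the chain determines it.
    stable   : ∀ {u} → u ≤ frees p → bracket (fill p u) ≡ (p , u)

open IsBracketing

isBracketing-true : ∀ {n} {X : Subset n} {p t} → IsBracketing X p t → IsBracketing (true ∷ X) (free ∷ p) (suc t)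
isBracketing-true {p = p} b = record
  { t≤frees  = s≤s (t≤frees b)
  ; fill≡    = cong (true ∷_) (fill≡ b)
  ; balanced = trans (+-suc _ (frees p)) (cong suc (balanced b))
  ; stable   = λ { {zero} _ → cong pushFalse (stable b z≤n) ; {suc u} (s≤s le) → cong pushTrue (stable b le) }
  }

isBracketing-false-free : ∀ {n} {X : Subset n} {p} → IsBracketing X p 0 → IsBracketing (false ∷ X) (free ∷ p) 0
isBracketing-false-free {p = p} b = record
  { t≤frees  = z≤n
  ; fill≡    = cong (false ∷_) (fill≡ b)
  ; balanced = trans (+-suc _ (frees p)) (cong suc (balanced b))
  ; stable   = λ { {zero} _ → cong pushFalse (stable b z≤n) ; {suc u} (s≤s le) → cong pushTrue (stable b le) }
  }

isBracketing-false-open : ∀ {n} {X : Subset n} {p t} → IsBracketing X p (suc t) →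
  IsBracketing (false ∷ X) (open′ ∷ closeFirst p) t
isBracketing-false-open {p = p} {t} b = record
  { t≤frees  = ≤-pred (≤-trans (t≤frees b) (≤-reflexive (sym (frees-closeFirst p 1≤frees))))
  ; fill≡    = cong (false ∷_) (trans (fill-closeFirst p t 1≤frees) (fill≡ b))
  ; balanced = trans (balance (closes p) (closes (closeFirst p)) (closes-closeFirst p 1≤frees))
                 (cong suc (trans (cong (closes p + closes p +_) (frees-closeFirst p 1≤frees)) (balanced b)))
  ; stable   = λ {u} le → cong pushFalse (trans (cong bracket (fill-closeFirst p u 1≤frees))
                 (stable b (≤-trans (s≤s le) (≤-reflexive (frees-closeFirst p 1≤frees)))))
  }
  where
  1≤frees : 1 ≤ frees p
  1≤frees = ≤-trans (s≤s z≤n) (t≤frees b)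
  balance : ∀ c d {g} → d ≡ suc c → d + d + g ≡ suc (c + c + suc g)
  balance c _ {g} refl = trans (cong (_+ g) (+-suc (suc c) c)) (cong suc (sym (+-suc (c + c) g)))

isBracketing : ∀ {n} (X : Subset n) → IsBracketing X (proj₁ (bracket X)) (proj₂ (bracket X))
isBracketing []          = record { t≤frees = z≤n ; fill≡ = refl ; balanced = refl ; stable = λ { z≤n → refl } }
isBracketing (true ∷ X)  = isBracketing-true (isBracketing X)
isBracketing (false ∷ X) with bracket X | isBracketing X
... | p , zero  | b = isBracketing-false-free b
... | p , suc t | b = isBracketing-false-open b

-- The member of size l of the symmetric chain through X, provided that the chain meets level l.
toLevel : ∀ {n} → ℕ → Subset n → Subset n
toLevel l X = fill p (l ∸ closes p)
  where p = proj₁ (bracket X)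

MeetsLevel : ∀ {n} → ℕ → Subset n → Set
MeetsLevel l X = closes p ≤ l × l ≤ closes p + frees p
  where p = proj₁ (bracket X)

∣X∣≡closes+t : ∀ {n} (X : Subset n) → ∣ X ∣ ≡ closes (proj₁ (bracket X)) + proj₂ (bracket X)
∣X∣≡closes+t X = trans (cong ∣_∣ (sym (fill≡ b))) (∣fill∣ (proj₁ (bracket X)) (t≤frees b))
  where b = isBracketing X

l∸closes≤frees : ∀ {n} l (X : Subset n) → MeetsLevel l X → l ∸ closes (proj₁ (bracket X)) ≤ frees (proj₁ (bracket X))
l∸closes≤frees l X (_ , l≤) = ≤-trans (∸-monoˡ-≤ (closes p) l≤) (≤-reflexive (m+n∸m≡n (closes p) (frees p)))
  where p = proj₁ (bracket X)

∣toLevel∣ : ∀ {n} l (X : Subset n) → MeetsLevel l X → ∣ toLevel l X ∣ ≡ l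
∣toLevel∣ l X ml@(c≤l , _) = trans (∣fill∣ (proj₁ (bracket X)) (l∸closes≤frees l X ml)) (m+[n∸m]≡n c≤l)

⊆-toLevel : ∀ {n} l (X : Subset n) → ∣ X ∣ ≤ l → X ⊆ toLevel l X
⊆-toLevel l X le = subst (_⊆ toLevel l X) (fill≡ (isBracketing X)) (fill-mono p t≤)
  where
  p = proj₁ (bracket X)
  t≤ : proj₂ (bracket X) ≤ l ∸ closes p
  t≤ = m+n≤o⇒m≤o∸n (proj₂ (bracket X)) (≤-trans (≤-reflexive (trans (+-comm _ (closes p)) (sym (∣X∣≡closes+t X)))) le)

toLevel-⊆ : ∀ {n} l (X : Subset n) → l ≤ ∣ X ∣ → toLevel l X ⊆ X
toLevel-⊆ l X le = subst (toLevel l X ⊆_) (fill≡ (isBracketing X)) (fill-mono p ≤t)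
  where
  p = proj₁ (bracket X)
  ≤t : l ∸ closes p ≤ proj₂ (bracket X)
  ≤t = m≤n+o⇒m∸n≤o l (closes p) (≤-trans le (≤-reflexive (∣X∣≡closes+t X)))

-- By `stable` the common image has the patterns of X and of Y, so both lie on one chain and are
-- ordered by their numbers of unmatched ")".
toLevel-comparable : ∀ {n} l (X Y : Subset n) → MeetsLevel l X → MeetsLevel l Y → toLevel l X ≡ toLevel l Y → X ⊆ Y ⊎ Y ⊆ X
toLevel-comparable l X Y mX mY eq = compare (≤-total (proj₂ (bracket X)) (proj₂ (bracket Y)))
  where
  bX = isBracketing X
  bY = isBracketing Y
  same : proj₁ (bracket X) ≡ proj₁ (bracket Y)
  same = trans (sym (cong proj₁ (stable bX (l∸closes≤frees l X mX))))
    (trans (cong (proj₁ ∘ bracket) eq) (cong proj₁ (stable bY (l∸closes≤frees l Y mY))))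
  X≡ : X ≡ fill (proj₁ (bracket Y)) (proj₂ (bracket X))
  X≡ = trans (sym (fill≡ bX)) (cong (λ p → fill p (proj₂ (bracket X))) same)
  compare : _ → X ⊆ Y ⊎ Y ⊆ X
  compare (inj₁ le) = inj₁ (subst₂ _⊆_ (sym X≡) (fill≡ bY) (fill-mono (proj₁ (bracket Y)) le))
  compare (inj₂ le) = inj₂ (subst₂ _⊆_ (fill≡ bY) (sym X≡) (fill-mono (proj₁ (bracket Y)) le))

module _ (h : ℕ) where
  private
    closes≤h : ∀ (X : Subset (2 * h)) → closes (proj₁ (bracket X)) ≤ h
    closes≤h X = *-cancelˡ-≤ 2 (≤-trans (≤-reflexive (cong (c +_) (+-identityʳ c))) (≤-trans (m≤m+n (c + c) (frees p)) (≤-reflexive (balanced (isBracketing X)))))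
      where
      p = proj₁ (bracket X)
      c = closes p

  meetsMiddle : ∀ (X : Subset (2 * h)) → MeetsLevel h X
  meetsMiddle X = closes≤h X , +-cancelˡ-≤ h _ _ (linear
      (≤-reflexive (sym (balanced (isBracketing X))) ⊕ closes≤h X)
      (rearrange h (closes p) (frees p)))
    where
    p = proj₁ (bracket X)
    rearrange : ∀ h c g → h + (c + g) + (2 * h + c) ≡ h + h + (c + c + g + h)
    rearrange = solve-∀

  -- A chain may consist of its middle member alone; here it reaches level h + 1 because it contains
  -- X.
  meetsAboveMiddle : ∀ (X : Subset (2 * h)) → suc h ≤ ∣ X ∣ → MeetsLevel (suc h) X
  meetsAboveMiddle X h<∣X∣ = m≤n⇒m≤1+n (closes≤h X) ,
    ≤-trans h<∣X∣ (≤-trans (≤-reflexive (∣X∣≡closes+t X)) (+-monoʳ-≤ _ (t≤frees (isBracketing X))))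

-- The profile of an antichain on the two middle levels.

middle-binomial : ∀ h → (2 * h) C h ≡ B h h
middle-binomial h = trans (cong (λ t → (h + t) C h) (+-identityʳ h)) (sym (B≡C h h))

above-middle-binomial : ∀ h → 1 ≤ h → (2 * h) C suc h ≡ shadowSum h (B h h)
above-middle-binomial (suc h) _ = begin
  (2 * suc h) C suc (suc h)                    ≡⟨ cong (_C suc (suc h)) (double h) ⟩
  (suc (suc h) + h) C suc (suc h)              ≡⟨ sym (B≡C (suc (suc h)) h) ⟩
  B (suc (suc h)) h                            ≡⟨ B-comm (suc (suc h)) h ⟩
  B h (suc (suc h))                            ≡⟨ sym (shadowSum-top h (suc h)) ⟩
  shadowSum (suc h) (B (suc h) (suc h))        ∎
  where
  open ≡-Reasoning
  double : ∀ h → 2 * suc h ≡ suc (suc h) + h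
  double = solve-∀

length-filter-split : ∀ {A : Set} {Q : A → Set} (Q? : ∀ x → Dec (Q x)) (xs : List A) →
  length xs ≡ length (filter Q? xs) + length (filter (¬? ∘ Q?) xs)
length-filter-split Q? []       = refl
length-filter-split Q? (x ∷ xs) with Q? x
... | yes _ = cong suc (length-filter-split Q? xs)
... | no  _ = trans (cong suc (length-filter-split Q? xs)) (sym (+-suc _ _))

map-unique : ∀ {A B : Set} (f : A → B) {xs} → (∀ {x y} → x ∈ xs → y ∈ xs → f x ≡ f y → x ≡ y) →
  Unique xs → Unique (List.map f xs)
map-unique f inj []            = []
map-unique f inj (x∉xs ∷ u) =
  All.map⁺ (All.tabulate (λ y∈xs fx≡fy → All.lookup x∉xs y∈xs (inj (here refl) (there y∈xs) fx≡fy)))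
    ∷ map-unique f (λ x∈ y∈ → inj (there x∈) (there y∈)) u

-- The antichain is moved to the two levels h and h + 1 along symmetric chains; the two images
-- satisfy the hypothesis of the Kruskal–Katona theorem.
module Profile (h : ℕ) (As : List (Subset (2 * h))) (unique : Unique As) (antichain : Antichain As) where
  private
    low  = filter (λ X → ∣ X ∣ ≤? h) As
    high = filter (¬? ∘ (λ X → ∣ X ∣ ≤? h)) As

    ∈low⁻ : ∀ {X} → X ∈ low → X ∈ As × ∣ X ∣ ≤ h
    ∈low⁻ = ∈-filter⁻ (λ X → ∣ X ∣ ≤? h)

    ∈high⁻ : ∀ {X} → X ∈ high → X ∈ As × suc h ≤ ∣ X ∣
    ∈high⁻ X∈ with ∈-filter⁻ (¬? ∘ (λ X → ∣ X ∣ ≤? h)) X∈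
    ... | X∈As , ∣X∣≰h = X∈As , ≰⇒> ∣X∣≰h

    comparable⇒≡ : ∀ {X Y} → X ∈ As → Y ∈ As → X ⊆ Y ⊎ Y ⊆ X → X ≡ Y
    comparable⇒≡ X∈ Y∈ (inj₁ X⊆Y) = antichain X∈ Y∈ X⊆Y
    comparable⇒≡ X∈ Y∈ (inj₂ Y⊆X) = sym (antichain Y∈ X∈ Y⊆X)

    middles = List.map (toLevel h) low
    uppers  = List.map (toLevel (suc h)) high

    unique-middles : Unique middles
    unique-middles = map-unique (toLevel h)
      (λ {X} {Y} X∈ Y∈ eq → comparable⇒≡ (proj₁ (∈low⁻ X∈)) (proj₁ (∈low⁻ Y∈))
        (toLevel-comparable h X Y (meetsMiddle h X) (meetsMiddle h Y) eq))
      (Unique.filter⁺ (λ X → ∣ X ∣ ≤? h) unique)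

    unique-uppers : Unique uppers
    unique-uppers = map-unique (toLevel (suc h))
      (λ {X} {Y} X∈ Y∈ eq → comparable⇒≡ (proj₁ (∈high⁻ X∈)) (proj₁ (∈high⁻ Y∈))
        (toLevel-comparable (suc h) X Y (meetsAboveMiddle h X (proj₂ (∈high⁻ X∈))) (meetsAboveMiddle h Y (proj₂ (∈high⁻ Y∈))) eq))
      (Unique.filter⁺ (¬? ∘ (λ X → ∣ X ∣ ≤? h)) unique)

  middle : Family (2 * h)
  middle = members middles

  middle-origin : ∀ X → T (middle X) → ∃ λ A → A ∈ As × ∣ A ∣ ≤ h × X ≡ toLevel h A
  middle-origin X p with ∈-map⁻ (toLevel h) (members⁻ middles p)
  ... | A , A∈ , X≡ = A , proj₁ (∈low⁻ A∈) , proj₂ (∈low⁻ A∈) , X≡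

  middle-level : ∀ X → T (middle X) → ∣ X ∣ ≡ h
  middle-level X p with middle-origin X p
  ... | A , _ , _ , refl = ∣toLevel∣ h A (meetsMiddle h A)

  private
    upper : Family (2 * h)
    upper = members uppers

    upper-origin : ∀ X → T (upper X) → ∃ λ A → A ∈ As × suc h ≤ ∣ A ∣ × X ≡ toLevel (suc h) A
    upper-origin X p with ∈-map⁻ (toLevel (suc h)) (members⁻ uppers p)
    ... | A , A∈ , X≡ = A , proj₁ (∈high⁻ A∈) , proj₂ (∈high⁻ A∈) , X≡

    upper-level : ∀ X → T (upper X) → ∣ X ∣ ≡ suc h
    upper-level X p with upper-origin X p
    ... | A , _ , h<∣A∣ , refl = ∣toLevel∣ (suc h) A (meetsAboveMiddle h A h<∣A∣)

    -- X contains its origin A, and Y is contained in its origin A′. So X ⊆ Y would give A ⊆ A′,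
    -- hence A = A′, against their sizes.
    middle-⊈-upper : ∀ X Y → T (middle X) → T (upper Y) → ¬ X ⊆ Y
    middle-⊈-upper X Y mX uY X⊆Y with middle-origin X mX | upper-origin Y uY
    ... | A , A∈ , ∣A∣≤h , refl | A′ , A′∈ , h<∣A′∣ , refl =
      <⇒≱ h<∣A′∣ (subst (λ Z → ∣ Z ∣ ≤ h)
        (antichain A∈ A′∈ (λ x∈A → toLevel-⊆ (suc h) A′ h<∣A′∣ (X⊆Y (⊆-toLevel h A ∣A∣≤h x∈A)))) ∣A∣≤h)

  length-bound : length As + shadowSum h (card middle) ≤ card middle + (2 * h) C suc h
  length-bound = linear
    (kruskal-katona (2 * h) h h (cong (h +_) (sym (+-identityʳ h))) middle upper middle-level upper-level middle-⊈-upper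
      ⊕ ≤-reflexive length-As)
    (rearrange (length As) (shadowSum h (card middle)) (card middle) (card upper) ((2 * h) C suc h))
    where
    length-As : length As ≡ card middle + card upper
    length-As = trans (length-filter-split (λ X → ∣ X ∣ ≤? h) As)
      (cong₂ _+_ (sym (trans (card-members unique-middles) (length-map (toLevel h) low)))
                 (sym (trans (card-members unique-uppers) (length-map (toLevel (suc h)) high))))
    rearrange : ∀ L f m u E → (m + E) + (f + u + L) ≡ (L + f) + (E + (m + u))
    rearrange = solve-∀

-- Two antichains with few disjoint pairs.

∈-take : ∀ {A : Set} k {xs : List A} (i : Fin (length xs)) → toℕ i < k → List.lookup xs i ∈ take k xs
∈-take (suc k) {x ∷ xs} zero    i<k       = here refl
∈-take (suc k) {x ∷ xs} (suc i) (s≤s i<k) = there (∈-take k i i<k)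

module _ (h k : ℕ) (As Bs : List (Subset (2 * h))) (uA : Unique As) (uB : Unique Bs)
         (aA : Antichain As) (aB : Antichain Bs) (few : FewDisjointPairs k As Bs) where
  private
    module A = Profile h As uA aA
    module B′ = Profile h Bs uB aB
    a  = A.middle
    bᶜ = B′.middle ∘ ∁

    ∣∁∣ : ∀ {X : Subset (2 * h)} → ∣ ∁ X ∣ ≡ h → ∣ X ∣ ≡ h
    ∣∁∣ {X} p = +-cancelʳ-≡ h _ _ (begin
      ∣ X ∣ + h                   ≡⟨ cong (∣ X ∣ +_) (trans (sym p) (∣∁p∣≡n∸∣p∣ X)) ⟩
      ∣ X ∣ + (2 * h ∸ ∣ X ∣)     ≡⟨ m+[n∸m]≡n (∣p∣≤n X) ⟩
      2 * h                       ≡⟨ cong (h +_) (+-identityʳ h) ⟩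
      h + h                       ∎)
      where open ≡-Reasoning

    N≡ : (2 * h) C h ≡ B h h
    N≡ = middle-binomial h

    card-a : card a ≤ B h h
    card-a = ≤-trans (card-≤-level h A.middle-level) (≤-reflexive N≡)

    card-b : card B′.middle ≤ B h h
    card-b = ≤-trans (card-≤-level h B′.middle-level) (≤-reflexive N≡)

    card-∪ : card (a ∪ᶠ bᶜ) ≤ B h h
    card-∪ = ≤-trans (card-≤-level h (λ X p → case (Equivalence.to (T-∨ {a X}) p))) (≤-reflexive N≡)
      where
      case : ∀ {X} → T (a X) ⊎ T (bᶜ X) → ∣ X ∣ ≡ h
      case {X} (inj₁ p) = A.middle-level X p
      case {X} (inj₂ p) = ∣∁∣ {X} (B′.middle-level (∁ X) p)

    common⊆ : ∀ X → T ((a ∩ᶠ bᶜ) X) → T (members (List.map (toLevel h) (take k As)) X)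
    common⊆ X p with A.middle-origin X (proj₁ (Equivalence.to T-∧ p)) | B′.middle-origin (∁ X) (proj₂ (Equivalence.to (T-∧ {a X}) p))
    ... | A , A∈ , ∣A∣≤h , refl | B , B∈ , ∣B∣≤h , ∁X≡ =
      members⁺ (∈-map⁺ (toLevel h) (subst (_∈ take k As) (sym (lookup-index A∈)) (∈-take k (Any.index A∈) (proj₂ (few (Any.index A∈) (Any.index B∈) disjoint)))))
      where
      -- Both origins were moved upwards, so A ⊆ X and B ⊆ `∁ X`.
      disjoint : Empty (List.lookup As (Any.index A∈) ∩ List.lookup Bs (Any.index B∈))
      disjoint (x , x∈) with x∈p∩q⁻ (List.lookup As (Any.index A∈)) _ x∈
      ... | x∈A , x∈B = x∈∁p⇒x∉p
        (subst (λ Z → x Data.Fin.Subset.∈ Z) (sym ∁X≡) (⊆-toLevel h B ∣B∣≤h (subst (λ Z → x Data.Fin.Subset.∈ Z) (sym (lookup-index B∈)) x∈B)))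
        (⊆-toLevel h A ∣A∣≤h (subst (λ Z → x Data.Fin.Subset.∈ Z) (sym (lookup-index A∈)) x∈A))

    card-∩ : card (a ∩ᶠ bᶜ) ≤ k
    card-∩ = begin
      card (a ∩ᶠ bᶜ)                                          ≤⟨ card-mono common⊆ ⟩
      card (members (List.map (toLevel h) (take k As)))       ≤⟨ card-members-≤ (List.map (toLevel h) (take k As)) ⟩
      length (List.map (toLevel h) (take k As))               ≡⟨ trans (length-map (toLevel h) (take k As)) (length-take k As) ⟩
      k ⊓ length As                                           ≤⟨ m⊓n≤m k _ ⟩
      k                                                       ∎
      where open ≤-Reasoning

    card-sum : card a + card B′.middle ≤ B h h + k
    card-sum = begin
      card a + card B′.middle                ≡⟨ cong (card a +_) (sym (card-∁ B′.middle)) ⟩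
      card a + card bᶜ                       ≡⟨ card-∪-∩ a bᶜ ⟩
      card (a ∪ᶠ bᶜ) + card (a ∩ᶠ bᶜ)        ≤⟨ card-∪ ⊕ card-∩ ⟩
      B h h + k                              ∎
      where open ≤-Reasoning
  antichain-pair-bound : 1 ≤ h → ℤ.+ (length As + length Bs) ℤ.≤ ℤ.+ ((2 * h) C h + (2 * h) C suc h) ℤ.- κ* h k
  antichain-pair-bound 1≤h
    with κ-bound h (card a) (card B′.middle) k (length As) (length Bs) card-a card-b card-sum
           (subst (λ E → length As + shadowSum h (card a) ≤ card a + E) (above-middle-binomial h 1≤h) A.length-bound)
           (subst (λ E → length Bs + shadowSum h (card B′.middle) ≤ card B′.middle + E) (above-middle-binomial h 1≤h) B′.length-bound)
  ... | j , j≤k , bound = ℤₚ.≤-trans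
    (ℕ-bound⇒ℤ (length As + length Bs) ((2 * h) C h + (2 * h) C suc h) (shadowSum h j) j
      (subst₂ (λ N E → length As + length Bs + shadowSum h j ≤ N + E + j) (sym N≡) (sym (above-middle-binomial h 1≤h)) bound))
    (ℤₚ.+-monoʳ-≤ (ℤ.+ ((2 * h) C h + (2 * h) C suc h)) (ℤₚ.neg-mono-≤ (κ*≤κ h j≤k)))

-- The squashed order

-- The squashed order is decided by the largest element, so the inductions on it split at the last
-- coordinate.
card-∷ʳ : ∀ {n} (P : Family (suc n)) → card P ≡ card (P ∘ (_∷ʳ false)) + card (P ∘ (_∷ʳ true))
card-∷ʳ {zero}  P = refl
card-∷ʳ {suc n} P = trans (cong₂ _+_ (card-∷ʳ (P ∘ (false ∷_))) (card-∷ʳ (P ∘ (true ∷_))))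
  (rearrange (card (λ X → P (false ∷ (X ∷ʳ false)))) (card (λ X → P (false ∷ (X ∷ʳ true))))
             (card (λ X → P (true ∷ (X ∷ʳ false)))) (card (λ X → P (true ∷ (X ∷ʳ true)))))
  where
  rearrange : ∀ a b c d → a + b + (c + d) ≡ a + c + (b + d)
  rearrange = solve-∀

∣∷ʳfalse∣ : ∀ {n} (X : Subset n) → ∣ X ∷ʳ false ∣ ≡ ∣ X ∣
∣∷ʳfalse∣ []          = refl
∣∷ʳfalse∣ (true ∷ X)  = cong suc (∣∷ʳfalse∣ X)
∣∷ʳfalse∣ (false ∷ X) = ∣∷ʳfalse∣ X

∣∷ʳtrue∣ : ∀ {n} (X : Subset n) → ∣ X ∷ʳ true ∣ ≡ suc ∣ X ∣
∣∷ʳtrue∣ []          = refl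
∣∷ʳtrue∣ (true ∷ X)  = cong suc (∣∷ʳtrue∣ X)
∣∷ʳtrue∣ (false ∷ X) = ∣∷ʳtrue∣ X

∷ʳ-⊆ : ∀ {n x y} (X Y : Subset n) → (X ∷ʳ x) ⊆ (Y ∷ʳ y) → X ⊆ Y × (x ≡ true → y ≡ true)
∷ʳ-⊆ []      []      sub = id , λ { refl → only (sub here) }
  where
  only : ∀ {y} → Fin.zero Data.Fin.Subset.∈ (y ∷ []) → y ≡ true
  only here = refl
∷ʳ-⊆ (x ∷ X) (y ∷ Y) sub with ∷ʳ-⊆ X Y (drop-∷-⊆ sub)
... | X⊆Y , last = (λ { here → head (sub here) ; (there i) → there (X⊆Y i) }) , last
  where
  head : ∀ {y m n} {Z : Subset m} {Y : Subset n} → Fin.zero Data.Fin.Subset.∈ (y ∷ Z) → Fin.zero Data.Fin.Subset.∈ (y ∷ Y)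
  head here = here

eqᵇ-∷ʳ : ∀ {n} b (X Y : Subset n) → eqᵇ (X ∷ʳ b) (Y ∷ʳ b) ≡ eqᵇ X Y
eqᵇ-∷ʳ true  []      []      = refl
eqᵇ-∷ʳ false []      []      = refl
eqᵇ-∷ʳ b     (x ∷ X) (y ∷ Y) = cong ((if x then y else not y) ∧_) (eqᵇ-∷ʳ b X Y)

eqᵇ-∷ʳ-≢ : ∀ {n} b (X Y : Subset n) → eqᵇ (X ∷ʳ b) (Y ∷ʳ not b) ≡ false
eqᵇ-∷ʳ-≢ true  []      []      = refl
eqᵇ-∷ʳ-≢ false []      []      = refl
eqᵇ-∷ʳ-≢ b     (x ∷ X) (y ∷ Y) = trans (cong ((if x then y else not y) ∧_) (eqᵇ-∷ʳ-≢ b X Y)) (∧-zeroʳ _)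

<ₛ-∷ʳ : ∀ {n} b (X Y : Subset n) → ((X ∷ʳ b) <ₛ (Y ∷ʳ b)) ≡ (X <ₛ Y)
<ₛ-∷ʳ true  []      []      = refl
<ₛ-∷ʳ false []      []      = refl
<ₛ-∷ʳ b     (x ∷ X) (y ∷ Y) = cong₂ (λ e l → if e then not x ∧ y else l) (eqᵇ-∷ʳ b X Y) (<ₛ-∷ʳ b X Y)

<ₛ-∷ʳ-≢ : ∀ {n} b (X Y : Subset n) → ((X ∷ʳ b) <ₛ (Y ∷ʳ not b)) ≡ not b
<ₛ-∷ʳ-≢ true  []      []      = refl
<ₛ-∷ʳ-≢ false []      []      = refl
<ₛ-∷ʳ-≢ b     (x ∷ X) (y ∷ Y) = cong₂ (λ e l → if e then not x ∧ y else l) (eqᵇ-∷ʳ-≢ b X Y) (<ₛ-∷ʳ-≢ b X Y)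

<ₛ-irrefl : ∀ {n} (X : Subset n) → ¬ T (X <ₛ X)
<ₛ-irrefl []      ()
<ₛ-irrefl (x ∷ X) p with eqᵇ X X | eqᵇ-refl X
<ₛ-irrefl (true ∷ X)  () | true | _
<ₛ-irrefl (false ∷ X) () | true | _

after : ∀ {n} → ℕ → Subset n → Family n
after q X Y = (∣ Y ∣ ≡ᵇ q) ∧ (X <ₛ Y)

length-filterᵇ-++ : ∀ {A : Set} (P : A → Bool) xs ys →
  length (filterᵇ P (xs ++ ys)) ≡ length (filterᵇ P xs) + length (filterᵇ P ys)
length-filterᵇ-++ P []       ys = refl
length-filterᵇ-++ P (x ∷ xs) ys with P x
... | true  = cong suc (length-filterᵇ-++ P xs ys)
... | false = length-filterᵇ-++ P xs ys

length-filterᵇ-map : ∀ {A B : Set} (f : A → B) (P : B → Bool) xs →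
  length (filterᵇ P (List.map f xs)) ≡ length (filterᵇ (P ∘ f) xs)
length-filterᵇ-map f P []       = refl
length-filterᵇ-map f P (x ∷ xs) with P (f x)
... | true  = cong suc (length-filterᵇ-map f P xs)
... | false = length-filterᵇ-map f P xs

length-filterᵇ-allSubsets : ∀ {n} (P : Family n) → length (filterᵇ P (allSubsets n)) ≡ card P
length-filterᵇ-allSubsets {zero} P with P []
... | true  = refl
... | false = refl
length-filterᵇ-allSubsets {suc n} P =
  trans (length-filterᵇ-++ P (List.map (false ∷_) (allSubsets n)) (List.map (true ∷_) (allSubsets n)))
    (cong₂ _+_ (trans (length-filterᵇ-map (false ∷_) P (allSubsets n)) (length-filterᵇ-allSubsets (P ∘ (false ∷_))))
               (trans (length-filterᵇ-map (true ∷_) P (allSubsets n)) (length-filterᵇ-allSubsets (P ∘ (true ∷_)))))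

numAfter≡card : ∀ {n} q (X : Subset n) → numAfter q X ≡ card (after q X)
numAfter≡card q X = length-filterᵇ-allSubsets (after q X)

card-≗ : ∀ {n} {P Q : Family n} → (∀ X → P X ≡ Q X) → card P ≡ card Q
card-≗ P≗Q = card-cong (λ X → subst T (P≗Q X)) (λ X → subst T (sym (P≗Q X)))

numAfter-true : ∀ {n} q (X : Subset n) → numAfter (suc q) (X ∷ʳ true) ≡ numAfter q X
numAfter-true q X = trans (numAfter≡card (suc q) (X ∷ʳ true)) (trans (card-∷ʳ (after (suc q) (X ∷ʳ true)))
  (trans (cong₂ _+_
    (card-none (λ Y p → subst T (<ₛ-∷ʳ-≢ true X Y) (proj₂ (Equivalence.to (T-∧ {∣ Y ∷ʳ false ∣ ≡ᵇ suc q}) p))))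
    (card-≗ (λ Y → cong₂ (λ s l → (s ≡ᵇ suc q) ∧ l) (∣∷ʳtrue∣ Y) (<ₛ-∷ʳ true X Y))))
  (sym (numAfter≡card q X))))

-- All `n C q` sets that contain the largest element come after one that does not.
numAfter-false : ∀ {n} q (X : Subset n) → numAfter (suc q) (X ∷ʳ false) ≡ numAfter (suc q) X + n C q
numAfter-false {n} q X = trans (numAfter≡card (suc q) (X ∷ʳ false)) (trans (card-∷ʳ (after (suc q) (X ∷ʳ false)))
  (cong₂ _+_
    (trans (card-≗ (λ Y → cong₂ (λ s l → (s ≡ᵇ suc q) ∧ l) (∣∷ʳfalse∣ Y) (<ₛ-∷ʳ false X Y))) (sym (numAfter≡card (suc q) X)))
    (trans (card-≗ (λ Y → trans (cong₂ (λ s l → (s ≡ᵇ suc q) ∧ l) (∣∷ʳtrue∣ Y) (<ₛ-∷ʳ-≢ false X Y)) (∧-identityʳ _))) (card-level n q))))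

numAfter-< : ∀ {n} q (X : Subset n) → ∣ X ∣ ≡ q → numAfter q X < n C q
numAfter-< {n} q X refl = begin
  suc (numAfter q X)                       ≡⟨ cong suc (numAfter≡card q X) ⟩
  1 + card (after q X)                     ≡⟨ cong (_+ card (after q X)) (sym (card-singleton X)) ⟩
  card (eqᵇ X) + card (after q X)          ≡⟨ sym (card-∪-disjoint (eqᵇ X) (after q X) disjoint) ⟩
  card (eqᵇ X ∪ᶠ after q X)                ≤⟨ card-≤-level q (λ Y p → case Y (Equivalence.to (T-∨ {eqᵇ X Y}) p)) ⟩
  n C q                                    ∎
  where
  open ≤-Reasoning
  disjoint : ∀ Y → T (eqᵇ X Y) → T (after q X Y) → ⊥
  disjoint Y X≡Y p with eqᵇ⇒≡ X Y X≡Y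
  ... | refl = <ₛ-irrefl X (proj₂ (Equivalence.to (T-∧ {∣ X ∣ ≡ᵇ q}) p))
  case : ∀ Y → T (eqᵇ X Y) ⊎ T (after q X Y) → ∣ Y ∣ ≡ q
  case Y (inj₁ X≡Y) = cong ∣_∣ (sym (eqᵇ⇒≡ X Y X≡Y))
  case Y (inj₂ p)   = ≡ᵇ⇒≡ ∣ Y ∣ q (proj₁ (Equivalence.to (T-∧ {∣ Y ∣ ≡ᵇ q}) p))

-- Final segments of the squashed order and their shades.

lastSets : ∀ {n} → ℕ → ℕ → Family n
lastSets q m X = (∣ X ∣ ≡ᵇ q) ∧ (numAfter q X <ᵇ m)

lastSets⁻ : ∀ {n} q m (X : Subset n) → T (lastSets q m X) → InL q m X
lastSets⁻ q m X p with Equivalence.to (T-∧ {∣ X ∣ ≡ᵇ q}) p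
... | l , a = ≡ᵇ⇒≡ ∣ X ∣ q l , <ᵇ⇒< _ m a

lastSets⁺ : ∀ {n} q m (X : Subset n) → InL q m X → T (lastSets q m X)
lastSets⁺ q m X (l , a) = Equivalence.from T-∧ (≡⇒≡ᵇ ∣ X ∣ q l , <⇒<ᵇ a)

InL-true⇔ : ∀ {n} q m (X : Subset n) → InL (suc q) m (X ∷ʳ true) ⇔ InL q m X
InL-true⇔ q m X = mk⇔
  (λ (l , a) → suc-injective (trans (sym (∣∷ʳtrue∣ X)) l) , subst (_< m) (numAfter-true q X) a)
  (λ (l , a) → trans (∣∷ʳtrue∣ X) (cong suc l) , subst (_< m) (sym (numAfter-true q X)) a)

InL-false⇔ : ∀ {n} q e (X : Subset n) → InL (suc q) (n C q + e) (X ∷ʳ false) ⇔ InL (suc q) e X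
InL-false⇔ {n} q e X = mk⇔
  (λ (l , a) → trans (sym (∣∷ʳfalse∣ X)) l , +-cancelˡ-< (n C q) _ _ (subst (_< n C q + e) shift a))
  (λ (l , a) → trans (∣∷ʳfalse∣ X) l , subst (_< n C q + e) (sym shift) (+-monoʳ-< (n C q) a))
  where
  shift : numAfter (suc q) (X ∷ʳ false) ≡ n C q + numAfter (suc q) X
  shift = trans (numAfter-false q X) (+-comm _ (n C q))

InL-false-small : ∀ {n} q m (X : Subset n) → m ≤ n C q → ¬ InL (suc q) m (X ∷ʳ false)
InL-false-small {n} q m X m≤C (_ , a) = <⇒≱ a (≤-trans m≤C (≤-trans (m≤n+m (n C q) _) (≤-reflexive (sym (numAfter-false q X)))))

-- A final segment either lies within the sets that contain the largest element, or takes all of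
-- them and a final segment of the others.
card-lastSets : ∀ n q m → m ≤ n C q → card {n} (lastSets q m) ≡ m
card-lastSets n       q       zero    m≤C = card-none {P = lastSets {n} q 0} (λ X p → n≮0 (proj₂ (lastSets⁻ q 0 X p)))
card-lastSets n       zero    (suc m) (s≤s z≤n) = trans
  (card-cong {n} (λ X p → ≡⇒≡ᵇ ∣ X ∣ 0 (proj₁ (lastSets⁻ 0 1 X p)))
             (λ X p → lastSets⁺ 0 1 X (≡ᵇ⇒≡ ∣ X ∣ 0 p , numAfter-< 0 X (≡ᵇ⇒≡ ∣ X ∣ 0 p))))
  (card-level n 0)
card-lastSets (suc n) (suc q) m@(suc _) m≤C with ≤-or-> (n C q) m
... | inj₁ m≤ = trans (card-∷ʳ {n} (lastSets (suc q) m)) (cong₂ _+_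
      (card-none {n} (λ X p → InL-false-small q m X m≤ (lastSets⁻ (suc q) m (X ∷ʳ false) p)))
      (trans (card-cong {n} (λ X p → lastSets⁺ q m X (Equivalence.to (InL-true⇔ q m X) (lastSets⁻ (suc q) m (X ∷ʳ true) p)))
                        (λ X p → lastSets⁺ (suc q) m (X ∷ʳ true) (Equivalence.from (InL-true⇔ q m X) (lastSets⁻ q m X p))))
             (card-lastSets n q m m≤)))
... | inj₂ (e , m≡) = trans (cong (λ t → card {suc n} (lastSets (suc q) t)) m≡)
      (trans (card-∷ʳ {n} (lastSets (suc q) m′)) (trans (cong₂ _+_
        (trans (card-cong {n} (λ X p → lastSets⁺ (suc q) (suc e) X (Equivalence.to (InL-false⇔ q (suc e) X) (lastSets⁻ (suc q) m′ (X ∷ʳ false) p)))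
                          (λ X p → lastSets⁺ (suc q) m′ (X ∷ʳ false) (Equivalence.from (InL-false⇔ q (suc e) X) (lastSets⁻ (suc q) (suc e) X p))))
               (card-lastSets n (suc q) (suc e) e≤))
        (trans (card-cong {n} (λ X p → ≡⇒≡ᵇ ∣ X ∣ q (proj₁ (Equivalence.to (InL-true⇔ q m′ X) (lastSets⁻ (suc q) m′ (X ∷ʳ true) p))))
                          (λ X p → lastSets⁺ (suc q) m′ (X ∷ʳ true) (Equivalence.from (InL-true⇔ q m′ X) (full X (≡ᵇ⇒≡ ∣ X ∣ q p)))))
               (card-level n q)))
      (trans (+-comm (suc e) (n C q)) (sym m≡))))
  where
  m′ = n C q + suc e
  e≤ : suc e ≤ n C suc q
  e≤ = +-cancelˡ-≤ (n C q) _ _ (≤-trans (≤-reflexive (sym m≡)) (≤-trans m≤C (≤-reflexive (sym (nCk+nC[k+1]≡[n+1]C[k+1] n q)))))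
  full : ∀ X → ∣ X ∣ ≡ q → InL q m′ X
  full X l = l , ≤-trans (numAfter-< q X l) (m≤m+n _ _)

InShadeL-∷ʳ : ∀ {n} q m z (Z : Subset n) → m ≤ n C q → InShadeL (suc q) m (Z ∷ʳ z) → z ≡ true × ∃ λ (Y : Subset n) → InL q m Y × Y ⊆ Z
InShadeL-∷ʳ q m z Z m≤C (_ , Y , inL , Y⊆Z) with initLast Y
... | Y′ , false , refl = ⊥-elim (InL-false-small q m Y′ m≤C inL)
... | Y′ , true  , refl = proj₂ (∷ʳ-⊆ Y′ Z Y⊆Z) refl , Y′ , Equivalence.to (InL-true⇔ q m Y′) inL , proj₁ (∷ʳ-⊆ Y′ Z Y⊆Z)

-- If all m sets contain the largest element, so does their shade, and it can be deleted. Otherwise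
-- the shade has at most `n C suc q` sets with that element and, without it, only the shade of the
-- remaining e′ sets; this is the recursion of `shadowSum-step`. The reverse bound comes from
-- `kruskal-katona`.
card-shade-≤ : ∀ n p q m → p + q ≡ n → m ≤ n C q → (S : Family n) → (∀ Z → T (S Z) → InShadeL q m Z) →
  card S ≤ shadowSum p m
card-shade-≤ n p q zero eq m≤C S sh = ≤-trans (≤-reflexive (card-none none)) z≤n
  where
  none : ∀ Z → ¬ T (S Z)
  none Z p with sh Z p
  ... | _ , _ , (_ , a) , _ = n≮0 a
card-shade-≤ n p zero (suc m) eq (s≤s z≤n) S sh = begin
  card S          ≤⟨ card-≤-level 1 (λ Z p → proj₁ (sh Z p)) ⟩
  n C 1           ≡⟨ nC1≡n n ⟩
  n               ≡⟨ sym (trans (sym (+-identityʳ p)) eq) ⟩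
  p               ≡⟨ sym (f-one p) ⟩
  shadowSum p 1   ∎
  where open ≤-Reasoning
card-shade-≤ zero p (suc q) (suc m) eq () S sh
card-shade-≤ (suc n) p (suc q) m@(suc _) eq m≤C S sh with ≤-or-> (n C q) m
... | inj₁ m≤ = begin
  card S                                              ≡⟨ card-∷ʳ {n} S ⟩
  card (S ∘ (_∷ʳ false)) + card (S ∘ (_∷ʳ true))      ≡⟨ cong (_+ card (S ∘ (_∷ʳ true))) (card-none (λ Z p → false≢true (proj₁ (InShadeL-∷ʳ q m false Z m≤ (sh (Z ∷ʳ false) p))))) ⟩
  card (S ∘ (_∷ʳ true))                               ≤⟨ card-shade-≤ n p q m (suc-injective (trans (sym (+-suc p q)) eq)) m≤ (S ∘ (_∷ʳ true)) sh′ ⟩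
  shadowSum p m                                       ∎
  where
  open ≤-Reasoning
  false≢true : false ≢ true
  false≢true ()
  sh′ : ∀ Z → T (S (Z ∷ʳ true)) → InShadeL q m Z
  sh′ Z p = suc-injective (trans (sym (∣∷ʳtrue∣ Z)) (proj₁ (sh (Z ∷ʳ true) p))) , proj₂ (InShadeL-∷ʳ q m true Z m≤ (sh (Z ∷ʳ true) p))
card-shade-≤ (suc n) zero (suc q) m@(suc _) refl m≤C S sh | inj₂ (e , m≡) =
  ≤-trans (card-≤-level (suc (suc q)) (λ Z p → proj₁ (sh Z p))) (≤-reflexive (k>n⇒nCk≡0 {suc q} ≤-refl))
card-shade-≤ (suc n) (suc p) (suc q) m@(suc _) eq m≤C S sh | inj₂ (e , m≡) = begin
  card S                                              ≡⟨ card-∷ʳ {n} S ⟩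
  card (S ∘ (_∷ʳ false)) + card (S ∘ (_∷ʳ true))      ≤⟨ card-shade-≤ n p (suc q) e′ (suc-injective eq) e≤ (S ∘ (_∷ʳ false)) sh′ ⊕ card-≤-level (suc q) (λ Z s → suc-injective (trans (sym (∣∷ʳtrue∣ Z)) (proj₁ (sh (Z ∷ʳ true) s)))) ⟩
  shadowSum p e′ + n C suc q                          ≡⟨ +-comm (shadowSum p e′) _ ⟩
  n C suc q + shadowSum p e′                          ≡⟨ cong (_+ shadowSum p e′) (sym K≡) ⟩
  B p (suc q) + shadowSum p e′                        ≡⟨ sym (shadowSum-step p q e′ (≤-trans e≤ (≤-reflexive (sym K≡)))) ⟩
  shadowSum (suc p) (B (suc p) q + e′)                ≡⟨ cong (λ t → shadowSum (suc p) (t + e′)) M≡ ⟩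
  shadowSum (suc p) (n C q + e′)                      ≡⟨ cong (shadowSum (suc p)) (sym m≡) ⟩
  shadowSum (suc p) m                                 ∎
  where
  open ≤-Reasoning
  e′ = suc e
  n≡ : p + suc q ≡ n
  n≡ = suc-injective eq
  K≡ : B p (suc q) ≡ n C suc q
  K≡ = trans (B-comm p (suc q)) (trans (B≡C (suc q) p) (cong (_C suc q) (trans (+-comm (suc q) p) n≡)))
  M≡ : B (suc p) q ≡ n C q
  M≡ = trans (B-comm (suc p) q) (trans (B≡C q (suc p)) (cong (_C q) (trans (+-comm q (suc p)) (trans (sym (+-suc p q)) n≡))))
  e≤ : e′ ≤ n C suc q
  e≤ = +-cancelˡ-≤ (n C q) _ _ (≤-trans (≤-reflexive (sym m≡)) (≤-trans m≤C (≤-reflexive (sym (nCk+nC[k+1]≡[n+1]C[k+1] n q)))))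
  sh′ : ∀ Z → T (S (Z ∷ʳ false)) → InShadeL (suc q) e′ Z
  sh′ Z s with sh (Z ∷ʳ false) s
  ... | l , Y , inL , Y⊆Z with initLast Y
  ...   | Y′ , true  , refl with proj₂ (∷ʳ-⊆ Y′ Z Y⊆Z) refl
  ...     | ()
  sh′ Z s | l , Y , inL , Y⊆Z | Y′ , false , refl =
    trans (sym (∣∷ʳfalse∣ Z)) l , Y′ ,
    Equivalence.to (InL-false⇔ q e′ Y′) (subst (λ t → InL (suc q) t (Y′ ∷ʳ false)) m≡ inL) , proj₁ (∷ʳ-⊆ Y′ Z Y⊆Z)

-- Sizes of the extremal families.

inL? : ∀ {n} q m (X : Subset n) → Dec (InL q m X)
inL? q m X = (∣ X ∣ ≟ q) ×-dec (numAfter q X <? m)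

inShadeL? : ∀ {n} q m (X : Subset n) → Dec (InShadeL q m X)
inShadeL? q m X = (∣ X ∣ ≟ suc q) ×-dec anySubset? (λ Y → inL? q m Y ×-dec (Y ⊆? X))

famII : ∀ {n} → ℕ → ℕ → Family n
famII q m = lastSets q m ∪ᶠ (λ X → ⌊ (∣ X ∣ ≟ suc q) ×-dec ¬? (inShadeL? q m X) ⌋)

-- The part U outside the shade is bounded above by `kruskal-katona` and below by `card-shade-≤`,
-- and the two bounds agree.
card-famII : ∀ h m → m ≤ (2 * h) C h → card {2 * h} (famII h m) + shadowSum h m ≡ m + (2 * h) C suc h
card-famII h m m≤C = trans (cong (_+ shadowSum h m) card-union) (trans (+-assoc m (card U) _) (cong (m +_) card-U))
  where
  n = 2 * h
  n≡ : h + h ≡ n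
  n≡ = cong (h +_) (sym (+-identityʳ h))
  S U L : Family n
  S X = ⌊ inShadeL? h m X ⌋
  U X = ⌊ (∣ X ∣ ≟ suc h) ×-dec ¬? (inShadeL? h m X) ⌋
  L = lastSets h m
  U⁻ : ∀ X → T (U X) → ∣ X ∣ ≡ suc h × ¬ InShadeL h m X
  U⁻ X = toWitness
  disjoint : ∀ X → T (L X) → T (U X) → ⊥
  disjoint X l u = 1+n≢n (trans (sym (proj₁ (U⁻ X u))) (proj₁ (lastSets⁻ h m X l)))
  card-union : card (famII {n} h m) ≡ m + card U
  card-union = trans (card-∪-disjoint L U disjoint) (cong (_+ card U) (card-lastSets n h m m≤C))
  lower : shadowSum h m + card U ≤ n C suc h
  lower = subst (λ t → shadowSum h t + card U ≤ n C suc h) (card-lastSets n h m m≤C)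
    (kruskal-katona n h h n≡ L U (λ X l → proj₁ (lastSets⁻ h m X l)) (λ X u → proj₁ (U⁻ X u))
      (λ X Y l u X⊆Y → proj₂ (U⁻ Y u) (proj₁ (U⁻ Y u) , X , lastSets⁻ h m X l , X⊆Y)))
  upper : n C suc h ≤ shadowSum h m + card U
  upper = begin
    n C suc h                        ≡⟨ sym (card-level n (suc h)) ⟩
    card {n} (level (suc h))         ≤⟨ card-mono cover ⟩
    card (S ∪ᶠ U)                    ≡⟨ card-∪-disjoint S U (λ X s u → proj₂ (U⁻ X u) (toWitness s)) ⟩
    card S + card U                  ≤⟨ +-monoˡ-≤ (card U) (card-shade-≤ n h h m n≡ m≤C S (λ Z → toWitness)) ⟩
    shadowSum h m + card U           ∎
    where
    open ≤-Reasoning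
    cover : ∀ X → T (level (suc h) X) → T ((S ∪ᶠ U) X)
    cover X l = cases (inShadeL? h m X)
      where
      cases : Dec (InShadeL h m X) → T ((S ∪ᶠ U) X)
      cases (yes s) = Equivalence.from (T-∨ {S X}) (inj₁ (fromWitness s))
      cases (no ¬s) = Equivalence.from (T-∨ {S X}) (inj₂ (fromWitness (≡ᵇ⇒≡ ∣ X ∣ (suc h) l , ¬s)))
  card-U : card U + shadowSum h m ≡ n C suc h
  card-U = trans (+-comm (card U) _) (≤-antisym lower upper)

length-level : ∀ {n} q {Xs : List (Subset n)} → Enumerates (Level q) Xs → length Xs ≡ n C q
length-level {n} q e = trans
  (enumerates-length (level q) (λ X → ≡ᵇ⇒≡ ∣ X ∣ q) (λ X → ≡⇒≡ᵇ ∣ X ∣ q) e) (card-level n q)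

length-famII : ∀ h m {Xs : List (Subset (2 * h))} → m ≤ (2 * h) C h → Enumerates (FamII h m) Xs →
  length Xs + shadowSum h m ≡ m + (2 * h) C suc h
length-famII h m m≤C e = trans (cong (_+ shadowSum h m) (enumerates-length (famII h m) sound complete e)) (card-famII h m m≤C)
  where
  sound : ∀ X → T (famII h m X) → FamII h m X
  sound X p with Equivalence.to (T-∨ {lastSets h m X}) p
  ... | inj₁ l = inj₁ (lastSets⁻ h m X l)
  ... | inj₂ u = inj₂ (toWitness u)
  complete : ∀ X → FamII h m X → T (famII h m X)
  complete X (inj₁ l) = Equivalence.from (T-∨ {lastSets h m X}) (inj₁ (lastSets⁺ h m X l))
  complete X (inj₂ u) = Equivalence.from (T-∨ {lastSets h m X}) (inj₂ (fromWitness u))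

open import Data.Integer using (+_)

theorem2p5 : (h : ℕ) → 2 ≤ h →
    ((k : ℕ) (As Bs : List (Subset (2 * h))) →
    Unique As → Unique Bs → Antichain As → Antichain Bs →
    k ≤ length As → k ≤ length Bs → FewDisjointPairs k As Bs →
    (+ (length As + length Bs)) ℤ.≤
    (+ ((2 * h) C h + (2 * h) C (suc h))) ℤ.- κ* h k)
    × ((k : ℕ) → (k < threshold h → κ* h k ≡ + 0) × (threshold h ≤ k → κ* h k ℤ.< + 0))
    × ((k : ℕ) (As Bs : List (Subset (2 * h))) → k < threshold h →
    Enumerates (Level h) As → Enumerates (Level (suc h)) Bs →
    k ≤ length As → k ≤ length Bs →
    (+ (length As + length Bs)) ≡
    (+ ((2 * h) C h + (2 * h) C (suc h))) ℤ.- κ* h k)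
    × ((k m : ℕ) (As Bs : List (Subset (2 * h))) → threshold h ≤ k →
    m ≤ k → κ* h k ≡ κ h m →
    Enumerates (Level h) As → Enumerates (FamII h m) Bs →
    k ≤ length As → k ≤ length Bs →
    (+ (length As + length Bs)) ≡
    (+ ((2 * h) C h + (2 * h) C (suc h))) ℤ.- κ* h k)
theorem2p5 h 2≤h =
    (λ k As Bs uA uB aA aB _ _ few → antichain-pair-bound h k As Bs uA uB aA aB few (<⇒≤ 2≤h))
  , (λ k → κ*-below-threshold h k , κ*-above-threshold h k)
  , (λ k As Bs k<t eA eB _ _ → trans
      (cong +_ (cong₂ _+_ (length-level h eA) (length-level (suc h) eB)))
      (trans (sym (ℤₚ.+-identityʳ _)) (cong (λ t → + ((2 * h) C h + (2 * h) C suc h) ℤ.- t) (sym (κ*-below-threshold h k k<t)))))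
  , (λ k m As Bs _ m≤k κ*≡κ eA eB k≤A _ → trans
      (ℕ-sum⇒ℤ (length As + length Bs) ((2 * h) C h + (2 * h) C suc h) (shadowSum h m) m
        (trans (+-assoc (length As) (length Bs) (shadowSum h m))
        -- `As` has `(2 * h) C h` members, so k ≤ |𝒜| keeps m in the range where the final segment
        -- has exactly m members.
        (trans (cong₂ _+_ (length-level h eA) (length-famII h m (≤-trans m≤k (≤-trans k≤A (≤-reflexive (length-level h eA)))) eB))
        (trans (cong (λ t → (2 * h) C h + t) (+-comm m ((2 * h) C suc h))) (sym (+-assoc ((2 * h) C h) _ m))))))
      (cong (λ t → + ((2 * h) C h + (2 * h) C suc h) ℤ.- t) (sym κ*≡κ)))
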